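{- There exists a constant $\beta>0$ such that for every connected $P_7$-free graph $G$ on at least two vertices, for every potential maximal clique $\Omega$ of $G$, and for every probability measure $\mu$ on $\Omega$, there exists a vertex $v\in V(G)$ satisfying $\mu(N(v))\ge\beta$.
   Context: All graphs are finite, simple and undirected; $P_7$-free means having no induced path on $7$ vertices. $N(v)$ is the open neighbourhood of $v$, and $\mu(N(v))$ means $\mu(N(v)\cap\Omega)$. A graph is chordal if every induced cycle has length three. A triangulation of $G$ is a set $F$ of non-edges of $G$ such that $(V(G),E(G)\cup F)$ is chordal; it is minimal if no proper subset of $F$ is a triangulation. A potential maximal clique of $G$ is a set $\Omega\subseteq V(G)$ that induces a maximal clique in $(V(G),E(G)\cup F)$ for some minimal triangulation $F$ of $G$.
   Formalization: The probability measure μ on Ω is taken to have rational weights instead of real ones (the real case follows by density and continuity). -}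

module Defs where

open import Data.Nat using (ℕ; zero; suc; _≤_)
open import Data.Fin using (Fin; toℕ) renaming (zero to fzero; suc to fsuc)
open import Data.Bool using (Bool; true; false; _∨_; _∧_; if_then_else_)
open import Data.Product using (Σ; _×_; ∃; ∃-syntax; _,_)
open import Data.Sum using (_⊎_)
open import Relation.Nullary using (¬_)
open import Relation.Binary.PropositionalEquality using (_≡_)
open import Function.Definitions using (Injective)
open import Function.Bundles using (_⇔_)
open import Data.Rational using (ℚ; 0ℚ; 1ℚ; _+_) renaming (_≤_ to _≤ℚ_)

record Graph : Set where
  field
    n      : ℕ
    adj    : Fin n → Fin n → Bool
    symm   : ∀ u v → adj u v ≡ adj v u
    irrefl : ∀ u → adj u u ≡ false

open Graph public

BRel : ℕ → Set
BRel n = Fin n → Fin n → Bool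

data Reachable (G : Graph) : Fin (n G) → Fin (n G) → Set where
  here : ∀ {u} → Reachable G u u
  step : ∀ {u w v} → adj G u w ≡ true → Reachable G w v → Reachable G u v

Connected : Graph → Set
Connected G = ∀ u v → Reachable G u v

PathStep : ∀ {k} → Fin k → Fin k → Set
PathStep i j = suc (toℕ i) ≡ toℕ j ⊎ suc (toℕ j) ≡ toℕ i

CycStep₀ : ∀ {k} → Fin k → Fin k → Set
CycStep₀ {k} i j = suc (toℕ i) ≡ toℕ j ⊎ (suc (toℕ i) ≡ k × toℕ j ≡ 0)

CycStep : ∀ {k} → Fin k → Fin k → Set
CycStep i j = CycStep₀ i j ⊎ CycStep₀ j i

IsInducedPath : ∀ {n} → BRel n → (k : ℕ) → (Fin k → Fin n) → Set
IsInducedPath A k f =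
  Injective _≡_ _≡_ f × (∀ i j → (A (f i) (f j) ≡ true) ⇔ PathStep i j)

IsInducedCycle : ∀ {n} → BRel n → (k : ℕ) → (Fin k → Fin n) → Set
IsInducedCycle A k f =
  3 ≤ k × Injective _≡_ _≡_ f × (∀ i j → (A (f i) (f j) ≡ true) ⇔ CycStep i j)

P7Free : Graph → Set
P7Free G = ¬ (Σ (Fin 7 → Fin (n G)) λ f → IsInducedPath (adj G) 7 f)

ChordalRel : ∀ {n} → BRel n → Set
ChordalRel A = ∀ k f → IsInducedCycle A k f → k ≡ 3

_+F_ : (G : Graph) → BRel (n G) → BRel (n G)
(G +F F) u v = adj G u v ∨ F u v

IsNonEdgeSet : (G : Graph) → BRel (n G) → Set
IsNonEdgeSet G F =
  (∀ u v → F u v ≡ F v u) × (∀ u → F u u ≡ false) ×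
  (∀ u v → F u v ≡ true → adj G u v ≡ false)

IsTriangulation : (G : Graph) → BRel (n G) → Set
IsTriangulation G F = IsNonEdgeSet G F × ChordalRel (G +F F)

_⊆F_ : ∀ {n} → BRel n → BRel n → Set
F' ⊆F F = ∀ u v → F' u v ≡ true → F u v ≡ true

_⊊F_ : ∀ {n} → BRel n → BRel n → Set
F' ⊊F F = F' ⊆F F × ∃[ u ] ∃[ v ] (F u v ≡ true × F' u v ≡ false)

IsMinimalTriangulation : (G : Graph) → BRel (n G) → Set
IsMinimalTriangulation G F =
  IsTriangulation G F × (∀ F' → F' ⊊F F → ¬ IsTriangulation G F')

VSet : ℕ → Set
VSet n = Fin n → Bool

IsClique : ∀ {n} → BRel n → VSet n → Set
IsClique A Ω = ∀ u v → Ω u ≡ true → Ω v ≡ true → ¬ u ≡ v → A u v ≡ true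

IsMaximalClique : ∀ {n} → BRel n → VSet n → Set
IsMaximalClique A Ω =
  IsClique A Ω × (∀ w → Ω w ≡ false → ∃[ u ] (Ω u ≡ true × ¬ u ≡ w × A u w ≡ false))

IsPMC : (G : Graph) → VSet (n G) → Set
IsPMC G Ω = ∃[ F ] (IsMinimalTriangulation G F × IsMaximalClique (G +F F) Ω)

sumFin : ∀ {n} → (Fin n → ℚ) → ℚ
sumFin {zero}  f = 0ℚ
sumFin {suc n} f = f fzero + sumFin {n} (λ i → f (fsuc i))

sumOver : ∀ {n} → VSet n → (Fin n → ℚ) → ℚ
sumOver S μ = sumFin (λ u → if S u then μ u else 0ℚ)

-- μ is a probability measure on Ω (weights of vertices of Ω; values
-- outside Ω are irrelevant)
IsProbMeasureOn : ∀ {n} → VSet n → (Fin n → ℚ) → Set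
IsProbMeasureOn Ω μ = (∀ u → Ω u ≡ true → 0ℚ ≤ℚ μ u) × sumOver Ω μ ≡ 1ℚ

-- μ(N(v)) = μ(N(v) ∩ Ω)
μN : (G : Graph) → VSet (n G) → (Fin (n G) → ℚ) → Fin (n G) → ℚ
μN G Ω μ v = sumOver (λ u → Ω u ∧ adj G v u) μ

{-# OPTIONS --safe #-}
-- Let Ω be a potential maximal clique all of whose vertex neighbourhoods in G are light. Two facts about
-- Ω are used: nonadjacent x, y ∈ Ω are joined through a component of G − Ω (else a smaller triangulation
-- exists), and no component of G − Ω sees all of Ω (else Ω is not maximal in the chordal graph).
-- Suppose D and E are disjoint sets with no edges between them, c ∈ D and w ∈ E, and each x in a set
-- X ⊆ Ω of constant mass has an induced path to c through D and another to w through E. These paths are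
-- short, so by a Markov argument X contains x, y, z such that none of them is on, or adjacent to, the
-- paths of the others. A shortest path from x to y inside their paths to c then has at least three edges
-- (its inner vertices see only one of x, y), and so has one from y to z inside their paths to w.
-- Joined at y they form an induced path on at least seven vertices.
-- If some component D has a boundary of mass ≥ γ, take any c ∈ D and w ∈ Ω unseen by D, and let E be
-- everything else outside Ω together with w. If all boundaries are smaller than γ, choose r = c and w in
-- Ω such that for most x the component joining x to r misses w and the one joining x to w misses r.
module Submission where

open import Defs
open import Data.Bool using (Bool; true; false; _∨_; _∧_; not; if_then_else_)
import Data.Bool.Properties as Bool
open import Data.Bool.ListAction using (any)
open import Data.Empty using (⊥; ⊥-elim)
open import Data.Fin using (Fin; toℕ; zero; suc; fromℕ<; inject₁)
open import Data.Fin.Induction using (<-weakInduction; >-weakInduction)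
import Data.Fin.Properties as Fin
open import Data.Integer using (+_)
open import Data.List using (List; []; _∷_; _++_; length; lookup; allFin)
open import Data.List.Membership.Propositional using (_∈_)
open import Data.List.Membership.Propositional.Properties using (∈-allFin; ∈-lookup)
import Data.List.Properties as List
open import Data.List.Relation.Unary.All using (All; []; _∷_)
import Data.List.Relation.Unary.All as All
import Data.List.Relation.Unary.All.Properties as All
open import Data.List.Relation.Unary.Any using (here; there)
open import Data.Nat using (ℕ; zero; suc; _≤_; z≤n; s≤s)
import Data.Nat as ℕ using (_+_; _<_)
import Data.Nat.Properties as ℕ
open import Data.Product using (Σ; _×_; ∃; ∃-syntax; _,_; proj₁; proj₂)
import Data.Rational
open import Data.Rational using (ℚ; 0ℚ; 1ℚ; ½; _+_; _*_; _/_; _<_; _<?_; nonNegative)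
  renaming (_≤_ to _≤ℚ_; _≤?_ to _≤ℚ?_)
import Data.Rational.Properties as ℚ
open import Data.Sum using (_⊎_; inj₁; inj₂; [_,_]′)
import Data.Sum as Sum
open import Function using (_∘_; id)
open import Function.Bundles using (_⇔_; mk⇔; Equivalence)
open import Relation.Nullary using (¬_; Dec; yes; no; does)
open import Relation.Nullary.Decidable
  using (_×-dec_; _⊎-dec_; ¬?; map′; does-⇔; dec-true; dec-false; decidable-stable; from-yes;
         ¬¬-excluded-middle)
open import Relation.Binary.PropositionalEquality

-- Induced paths and cycles

true≢false : ∀ {b} → b ≡ true → b ≡ false → ⊥
true≢false refl ()

-- The first vertex is exempt from `P`; hence the assumption `P u` in `conn-sym` and `conn-target`.
data Conn {n} (A : BRel n) (P : Fin n → Set) : Fin n → Fin n → Set where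
  nil  : ∀ {u} → Conn A P u u
  cons : ∀ {u v w} → A u v ≡ true → P v → Conn A P v w → Conn A P u w

module _ {n} {A : BRel n} {P : Fin n → Set} where

  conn-trans : ∀ {u v w} → Conn A P u v → Conn A P v w → Conn A P u w
  conn-trans nil          q = q
  conn-trans (cons e p r) q = cons e p (conn-trans r q)

  conn-snoc : ∀ {u v w} → Conn A P u v → A v w ≡ true → P w → Conn A P u w
  conn-snoc r e p = conn-trans r (cons e p nil)

  conn-sym : (∀ u v → A u v ≡ A v u) → ∀ {u v} → P u → Conn A P u v → Conn A P v u
  conn-sym A-sym pu nil                    = nil
  conn-sym A-sym pu (cons {u} {v} e pv r) =
    conn-snoc (conn-sym A-sym pv r) (trans (A-sym v u) e) pu

  conn-target : ∀ {u v} → P u → Conn A P u v → P v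
  conn-target pu nil           = pu
  conn-target pu (cons _ pv r) = conn-target pv r

  -- Every vertex passed is again reachable from `c`, so the predicate sharpens to membership in the
  -- part reached from `c`. This keeps walks inside one component.
  conn-lift : ∀ {c u v} → Conn A P c u → Conn A P u v → Conn A (Conn A P c) u v
  conn-lift cu nil          = nil
  conn-lift cu (cons e p r) = cons e cv (conn-lift cv r)
    where cv = conn-snoc cu e p

conn-map : ∀ {n} {A B : BRel n} {P : Fin n → Set} → (∀ {u v} → A u v ≡ true → B u v ≡ true) →
           ∀ {u v} → Conn A P u v → Conn B P u v
conn-map f nil          = nil
conn-map f (cons e p r) = cons (f e) p (conn-map f r)

module Paths {n : ℕ} (A : BRel n)
             (A-sym : ∀ u v → A u v ≡ A v u) (A-irr : ∀ u → A u u ≡ false) where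

  private
    V : Set
    V = Fin n

  Apart : V → V → Set
  Apart u v = ¬ u ≡ v × A u v ≡ false

  flip-edge : ∀ {u v} → A u v ≡ true → A v u ≡ true
  flip-edge {u} {v} e = trans (A-sym v u) e

  edge⇒≢ : ∀ {u v} → A u v ≡ true → ¬ u ≡ v
  edge⇒≢ {u} e refl = true≢false e (A-irr u)

  edge? : ∀ u v → A u v ≡ true ⊎ A u v ≡ false
  edge? u v with A u v
  ... | true  = inj₁ refl
  ... | false = inj₂ refl

  -- Induced u vs: the sequence u ∷ vs is an induced path.
  data Induced : V → List V → Set where
    []   : ∀ {u} → Induced u []
    cons : ∀ {u v vs} → A u v ≡ true → All (Apart u) vs → Induced v vs → Induced u (v ∷ vs)

  -- PathTo P t u vs: u ∷ vs is an induced path ending in t whose inner vertices satisfy P.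
  data PathTo (P : V → Set) (t : V) : V → List V → Set where
    edge : ∀ {u} → A u t ≡ true → PathTo P t u (t ∷ [])
    cons : ∀ {u v vs} → A u v ≡ true → P v → All (Apart u) vs → PathTo P t v vs →
           PathTo P t u (v ∷ vs)

  -- Unlike in `Conn`, both ends are exempt from `P` and there is at least one edge: the ends may
  -- lie in Ω while the interior avoids it.
  data Walk (P : V → Set) (t : V) : V → Set where
    edge : ∀ {u} → A u t ≡ true → Walk P t u
    step : ∀ {u v} → A u v ≡ true → P v → Walk P t v → Walk P t u

  pathTo⇒induced : ∀ {P t u vs} → PathTo P t u vs → Induced u vs
  pathTo⇒induced (edge e)       = cons e [] []
  pathTo⇒induced (cons e _ a p) = cons e a (pathTo⇒induced p)

  pathTo-map : ∀ {P Q : V → Set} {t u vs} → (∀ {v} → P v → Q v) → PathTo P t u vs → PathTo Q t u vs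
  pathTo-map f (edge e)       = edge e
  pathTo-map f (cons e p a q) = cons e (f p) a (pathTo-map f q)

  pathTo-all : ∀ {P t u vs} → P t → PathTo P t u vs → All P vs
  pathTo-all pt (edge _)       = pt ∷ []
  pathTo-all pt (cons _ q _ p) = q ∷ pathTo-all pt p

  pathTo-end : ∀ {P t u vs} → PathTo P t u vs → t ∈ vs
  pathTo-end (edge _)       = here refl
  pathTo-end (cons _ _ _ p) = there (pathTo-end p)

  walk-map : ∀ {P Q : V → Set} {t u} → (∀ {v} → P v → Q v) → Walk P t u → Walk Q t u
  walk-map f (edge e)     = edge e
  walk-map f (step e p w) = step e (f p) (walk-map f w)

  walk-trans : ∀ {P s t u} → Walk P t u → P t → Walk P s t → Walk P s u
  walk-trans (edge e)     pt w′ = step e pt w′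
  walk-trans (step e p w) pt w′ = step e p (walk-trans w pt w′)

  walk-reverse : ∀ {P t u} → Walk P t u → Walk P u t
  walk-reverse (edge e)     = edge (flip-edge e)
  walk-reverse (step e p w) = walk-trans (walk-reverse w) p (edge (flip-edge e))

  conn⇒walk : ∀ {P x u v} → A x u ≡ true → P u → Conn A P u v → Walk P v x
  conn⇒walk e pu nil            = edge e
  conn⇒walk e pu (cons e′ pv r) = step e pu (conn⇒walk e′ pv r)

  pathTo⇒walk : ∀ {P t u vs} → PathTo P t u vs → Walk (_∈ vs) t u
  pathTo⇒walk (edge e)       = edge e
  pathTo⇒walk (cons e _ _ p) = step e (here refl) (walk-map there (pathTo⇒walk p))

  first-edge : ∀ {P t u v vs} → PathTo P t u (v ∷ vs) → A u v ≡ true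
  first-edge (edge e)       = e
  first-edge (cons e _ _ _) = e

  -- Jump from u to its last neighbour on the path.
  attach : ∀ {P t u v vs} → ¬ u ≡ t → PathTo P t v vs →
           All (Apart u) vs ⊎ ∃ (PathTo P t u)
  attach {t = t} {u = u} u≢t (edge _) with edge? u t
  ... | inj₁ e = inj₂ (_ , edge e)
  ... | inj₂ e = inj₁ ((u≢t , e) ∷ [])
  attach {u = u} u≢t (cons {v = v} _ pv _ p) with attach u≢t p
  ... | inj₂ found = inj₂ found
  ... | inj₁ far with edge? u v
  ...   | inj₁ e = inj₂ (_ , cons e pv far p)
  ...   | inj₂ e = inj₁ ((u≢v p far , e) ∷ far)
    where
    u≢v : ∀ {P t v vs} → PathTo P t v vs → All (Apart u) vs → ¬ u ≡ v
    u≢v (edge e)       (a ∷ _) refl = true≢false e (proj₂ a)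
    u≢v (cons e _ _ _) (a ∷ _) refl = true≢false e (proj₂ a)

  -- By induction the tail from `v` is already an induced path. Either `u` sees a later vertex of it
  -- and `attach` jumps there, or `v` is the only neighbour of `u` on it and `u` can be prepended.
  shortcut : ∀ {P t u} → ¬ u ≡ t → Walk P t u → ∃ (PathTo P t u)
  shortcut u≢t (edge e) = _ , edge e
  shortcut {t = t} u≢t (step {v = v} e pv w) with v Fin.≟ t
  ... | yes refl = _ , edge e
  ... | no v≢t with shortcut v≢t w
  ...   | _ , p with attach u≢t p
  ...     | inj₁ far   = _ , cons e pv far p
  ...     | inj₂ found = found

  induced-++ : ∀ {P t u vs ws} → PathTo P t u vs → Induced t ws →
               All (Apart u) ws → (∀ {v} → P v → All (Apart v) ws) → Induced u (vs ++ ws)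
  induced-++ (edge e)        q u-ws P-ws = cons e u-ws q
  induced-++ (cons e pv a p) q u-ws P-ws =
    cons e (All.++⁺ a u-ws) (induced-++ p q (P-ws pv) P-ws)

  apart-lookup : ∀ {u vs} → All (Apart u) vs → ∀ j → Apart u (lookup vs j)
  apart-lookup as j = All.lookup as (∈-lookup j)

  head-adj⇒ : ∀ {u vs} → Induced u vs → ∀ j → A u (lookup vs j) ≡ true → toℕ j ≡ 0
  head-adj⇒ (cons _ _ _) zero    _ = refl
  head-adj⇒ (cons _ a _) (suc j) e = ⊥-elim (true≢false e (proj₂ (apart-lookup a j)))

  head-adj⇐ : ∀ {u vs} → Induced u vs → ∀ j → toℕ j ≡ 0 → A u (lookup vs j) ≡ true
  head-adj⇐ (cons e _ _) zero _ = e

  head-≢ : ∀ {u vs} → Induced u vs → ∀ j → ¬ u ≡ lookup vs j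
  head-≢ (cons e _ _) zero    = edge⇒≢ e
  head-≢ (cons _ a _) (suc j) = proj₁ (apart-lookup a j)

  lookup-injective : ∀ {u vs} → Induced u vs → ∀ i j →
                     lookup (u ∷ vs) i ≡ lookup (u ∷ vs) j → i ≡ j
  lookup-injective p zero    zero    _  = refl
  lookup-injective p zero    (suc j) eq = ⊥-elim (head-≢ p j eq)
  lookup-injective p (suc i) zero    eq = ⊥-elim (head-≢ p i (sym eq))
  lookup-injective (cons _ _ p) (suc i) (suc j) eq = cong suc (lookup-injective p i j eq)

  lookup-step⇒ : ∀ {u vs} → Induced u vs → ∀ i j →
                 A (lookup (u ∷ vs) i) (lookup (u ∷ vs) j) ≡ true → PathStep i j
  lookup-step⇒ {u} p zero zero e = ⊥-elim (true≢false e (A-irr u))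
  lookup-step⇒ p zero    (suc j) e = inj₁ (cong suc (sym (head-adj⇒ p j e)))
  lookup-step⇒ p (suc i) zero    e = inj₂ (cong suc (sym (head-adj⇒ p i (flip-edge e))))
  lookup-step⇒ (cons _ _ p) (suc i) (suc j) e =
    Sum.map (cong suc) (cong suc) (lookup-step⇒ p i j e)

  lookup-step⇐ : ∀ {u vs} → Induced u vs → ∀ i j → PathStep i j →
                 A (lookup (u ∷ vs) i) (lookup (u ∷ vs) j) ≡ true
  lookup-step⇐ p zero zero (inj₁ ())
  lookup-step⇐ p zero zero (inj₂ ())
  lookup-step⇐ p zero (suc j) (inj₁ s) = head-adj⇐ p j (sym (ℕ.suc-injective s))
  lookup-step⇐ p (suc i) zero (inj₂ s) = flip-edge (head-adj⇐ p i (sym (ℕ.suc-injective s)))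
  lookup-step⇐ (cons _ _ p) (suc i) (suc j) s =
    lookup-step⇐ p i j (Sum.map ℕ.suc-injective ℕ.suc-injective s)

  induced⇒inducedPath : ∀ {u vs} → Induced u vs → IsInducedPath A (suc (length vs)) (lookup (u ∷ vs))
  induced⇒inducedPath p =
    lookup-injective p _ _ , λ i j → mk⇔ (lookup-step⇒ p i j) (lookup-step⇐ p i j)

  prefix : ∀ {u} vs {ws} → Induced u (vs ++ ws) → Induced u vs
  prefix []       _            = []
  prefix (v ∷ vs) (cons e a p) = cons e (All.++⁻ˡ vs a) (prefix vs p)

  -- The list omits the starting vertex, so six entries mean seven vertices.
  long⇒P7 : ∀ {u vs} → Induced u vs → 6 ≤ length vs →
            Σ (Fin 7 → V) (IsInducedPath A 7)
  long⇒P7 {vs = a ∷ b ∷ c ∷ d ∷ e ∷ f ∷ _} p _ =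
    _ , induced⇒inducedPath (prefix (a ∷ b ∷ c ∷ d ∷ e ∷ f ∷ []) p)
  long⇒P7 {vs = []} _ ()
  long⇒P7 {vs = _ ∷ []} _ (s≤s ())
  long⇒P7 {vs = _ ∷ _ ∷ []} _ (s≤s (s≤s ()))
  long⇒P7 {vs = _ ∷ _ ∷ _ ∷ []} _ (s≤s (s≤s (s≤s ())))
  long⇒P7 {vs = _ ∷ _ ∷ _ ∷ _ ∷ []} _ (s≤s (s≤s (s≤s (s≤s ()))))
  long⇒P7 {vs = _ ∷ _ ∷ _ ∷ _ ∷ _ ∷ []} _ (s≤s (s≤s (s≤s (s≤s (s≤s ())))))

  -- The closing condition of an induced cycle: a vertex `v` adjacent to the start of an induced
  -- path closes it up when, on the rest, it sees the far end alone.
  data OnlyLast (v : V) : List V → Set where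
    last  : ∀ {u} → A v u ≡ true → OnlyLast v (u ∷ [])
    later : ∀ {u us} → Apart v u → OnlyLast v us → OnlyLast v (u ∷ us)

  onlyLast⇒ : ∀ {v us} → OnlyLast v us → ∀ j → A v (lookup us j) ≡ true → suc (toℕ j) ≡ length us
  onlyLast⇒ (last _)    zero    _ = refl
  onlyLast⇒ (later a _) zero    e = ⊥-elim (true≢false e (proj₂ a))
  onlyLast⇒ (later _ o) (suc j) e = cong suc (onlyLast⇒ o j e)

  onlyLast⇐ : ∀ {v us} → OnlyLast v us → ∀ j → suc (toℕ j) ≡ length us → A v (lookup us j) ≡ true
  onlyLast⇐ (last e)              zero    _  = e
  onlyLast⇐ (later _ (last _))    zero    ()
  onlyLast⇐ (later _ (later _ _)) zero    ()
  onlyLast⇐ (later _ o)           (suc j) eq = onlyLast⇐ o j (ℕ.suc-injective eq)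

  onlyLast-≢ : ∀ {v us} → OnlyLast v us → ∀ j → ¬ v ≡ lookup us j
  onlyLast-≢ (last e)    zero    = edge⇒≢ e
  onlyLast-≢ (later a _) zero    = proj₁ a
  onlyLast-≢ (later _ o) (suc j) = onlyLast-≢ o j

  onlyLast-nonempty : ∀ {v us} → OnlyLast v us → 1 ≤ length us
  onlyLast-nonempty (last _)    = s≤s z≤n
  onlyLast-nonempty (later _ _) = s≤s z≤n

  closed⇒inducedCycle : ∀ {v u us} → A v u ≡ true → Induced u us → OnlyLast v us →
                        IsInducedCycle A (2 ℕ.+ length us) (lookup (v ∷ u ∷ us))
  closed⇒inducedCycle {v} {u} {us} vu p o =
    s≤s (s≤s (onlyLast-nonempty o)) , injective _ _ , λ i j → mk⇔ (to i j) (from i j)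
    where
    k : ℕ
    k = 2 ℕ.+ length us
    L : List V
    L = v ∷ u ∷ us
    injective : ∀ i j → lookup L i ≡ lookup L j → i ≡ j
    injective zero          zero          _  = refl
    injective zero          (suc zero)    eq = ⊥-elim (edge⇒≢ vu eq)
    injective zero          (suc (suc j)) eq = ⊥-elim (onlyLast-≢ o j eq)
    injective (suc zero)    zero          eq = ⊥-elim (edge⇒≢ vu (sym eq))
    injective (suc (suc i)) zero          eq = ⊥-elim (onlyLast-≢ o i (sym eq))
    injective (suc i)       (suc j)       eq = cong suc (lookup-injective p i j eq)
    toHead : ∀ j → A v (lookup (u ∷ us) j) ≡ true → CycStep {k} zero (suc j)
    toHead zero    _ = inj₁ (inj₁ refl)
    toHead (suc j) e = inj₂ (inj₂ (cong suc (cong suc (onlyLast⇒ o j e)) , refl))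
    fromHead : ∀ j → CycStep {k} zero (suc j) → A v (lookup (u ∷ us) j) ≡ true
    fromHead zero    _                     = vu
    fromHead (suc j) (inj₁ (inj₁ ()))
    fromHead (suc j) (inj₁ (inj₂ (() , _)))
    fromHead (suc j) (inj₂ (inj₂ (eq , _))) =
      onlyLast⇐ o j (ℕ.suc-injective (ℕ.suc-injective eq))
    to : ∀ i j → A (lookup L i) (lookup L j) ≡ true → CycStep {k} i j
    to zero    zero    e = ⊥-elim (true≢false e (A-irr v))
    to zero    (suc j) e = toHead j e
    to (suc i) zero    e = Sum.swap (toHead i (flip-edge e))
    to (suc i) (suc j) e with lookup-step⇒ p i j e
    ... | inj₁ s = inj₁ (inj₁ (cong suc s))
    ... | inj₂ s = inj₂ (inj₁ (cong suc s))
    from : ∀ i j → CycStep {k} i j → A (lookup L i) (lookup L j) ≡ true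
    from zero    zero    (inj₁ (inj₁ ()))
    from zero    zero    (inj₁ (inj₂ (() , _)))
    from zero    zero    (inj₂ (inj₁ ()))
    from zero    zero    (inj₂ (inj₂ (() , _)))
    from zero    (suc j) s = fromHead j s
    from (suc i) zero    s = flip-edge (fromHead i (Sum.swap s))
    from (suc i) (suc j) (inj₁ (inj₁ s)) = lookup-step⇐ p i j (inj₁ (ℕ.suc-injective s))
    from (suc i) (suc j) (inj₂ (inj₁ s)) = lookup-step⇐ p i j (inj₂ (ℕ.suc-injective s))

  onlyLast-length : ChordalRel A → ∀ {v u us} → A v u ≡ true → Induced u us → OnlyLast v us →
                    length us ≡ 1
  onlyLast-length chordal vu p o =
    ℕ.suc-injective (ℕ.suc-injective (chordal _ _ (closed⇒inducedCycle vu p o)))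

  -- Scanning from the start must stop, as `t` itself is a neighbour of `v`; cutting at the first
  -- hit leaves a segment that `v` closes into a cycle.
  first-neighbour : ∀ {v t u us} → PathTo (λ w → ¬ v ≡ w) t u us → A v t ≡ true →
                    ∃[ ws ] (∃[ xs ] us ≡ ws ++ xs) × OnlyLast v ws
  first-neighbour (edge _) vt = _ , ([] , refl) , last vt
  first-neighbour {v} (cons {v = w} _ v≢w _ p) vt with edge? v w
  ... | inj₁ e = w ∷ [] , (_ , refl) , last e
  ... | inj₂ e with first-neighbour p vt
  ...   | ws , (xs , eq) , o = w ∷ ws , (xs , cong (w ∷_) eq) , later (v≢w , e) o

  -- Otherwise v, the vertex s and the path up to the first neighbour of v form a long induced cycle.
  chordal⇒second-adjacent : ChordalRel A → ∀ {v s t u us} → A v s ≡ true → A v t ≡ true →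
    PathTo (λ w → ¬ v ≡ w) t s (u ∷ us) → A v u ≡ true
  chordal⇒second-adjacent chordal vs vt (edge _) = vt
  chordal⇒second-adjacent chordal {v} {s} vs vt (cons {v = u} e v≢u a q) with edge? v u
  ... | inj₁ vu = vu
  ... | inj₂ vu with first-neighbour q vt
  ...   | ws , (xs , refl) , o = ⊥-elim (ℕ.<⇒≢ (s≤s (onlyLast-nonempty o)) (sym length≡1))
    where
    length≡1 : suc (length ws) ≡ 1
    length≡1 = onlyLast-length chordal vs
                 (cons e (All.++⁻ˡ ws a) (prefix ws (pathTo⇒induced q))) (later (v≢u , vu) o)

-- Potential maximal cliques

module Rotation {m : ℕ} where

  next : Fin (suc m) → Fin (suc m)
  next i with suc (toℕ i) ℕ.<? suc m
  ... | yes i+1<k = fromℕ< i+1<k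
  ... | no  _     = zero

  next-step : ∀ i → CycStep₀ i (next i)
  next-step i with suc (toℕ i) ℕ.<? suc m
  ... | yes i+1<k = inj₁ (sym (Fin.toℕ-fromℕ< i+1<k))
  ... | no  i+1≮k = inj₂ (ℕ.≤-antisym (Fin.toℕ<n i) (ℕ.≮⇒≥ i+1≮k) , refl)

  step-unique : ∀ {i j j′ : Fin (suc m)} → CycStep₀ i j → CycStep₀ i j′ → j ≡ j′
  step-unique (inj₁ p) (inj₁ q) = Fin.toℕ-injective (trans (sym p) q)
  step-unique {j = j} (inj₁ p) (inj₂ (q , _)) = ⊥-elim (ℕ.<⇒≢ (Fin.toℕ<n j) (trans (sym p) q))
  step-unique {j′ = j} (inj₂ (q , _)) (inj₁ p) = ⊥-elim (ℕ.<⇒≢ (Fin.toℕ<n j) (trans (sym p) q))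
  step-unique (inj₂ (_ , p)) (inj₂ (_ , q)) = Fin.toℕ-injective (trans p (sym q))

  step-injective : ∀ {i i′ j : Fin (suc m)} → CycStep₀ i j → CycStep₀ i′ j → i ≡ i′
  step-injective (inj₁ p) (inj₁ q) = Fin.toℕ-injective (ℕ.suc-injective (trans p (sym q)))
  step-injective (inj₁ p) (inj₂ (_ , q)) = ⊥-elim (ℕ.1+n≢0 (trans p q))
  step-injective (inj₂ (_ , q)) (inj₁ p) = ⊥-elim (ℕ.1+n≢0 (trans p q))
  step-injective (inj₂ (p , _)) (inj₂ (q , _)) =
    Fin.toℕ-injective (ℕ.suc-injective (trans p (sym q)))

  next-injective : ∀ {i j} → next i ≡ next j → i ≡ j
  next-injective {i} {j} eq = step-injective (next-step i) (subst (CycStep₀ j) (sym eq) (next-step j))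

  step₀-next : ∀ {i j} → CycStep₀ i j ⇔ CycStep₀ (next i) (next j)
  step₀-next {i} {j} = mk⇔
    (λ s → subst (CycStep₀ (next i) ∘ next) (step-unique (next-step i) s) (next-step (next i)))
    (λ s → subst (CycStep₀ i) (next-injective (step-unique (next-step (next i)) s)) (next-step i))

  -- Shifting all indices by `next` preserves cyclic adjacency and moves the vertex at `suc i` to
  -- `inject₁ i`, where the induction hypothesis applies. It lets a cycle be assumed to start
  -- outside Ω.
  rotate : ∀ {n} {A : BRel n} i (f : Fin (suc m) → Fin n) → IsInducedCycle A (suc m) f →
           ∃[ g ] IsInducedCycle A (suc m) g × g zero ≡ f i
  rotate {n} {A} = <-weakInduction
    (λ i → ∀ f → IsInducedCycle A (suc m) f → ∃[ g ] IsInducedCycle A (suc m) g × g zero ≡ f i)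
    (λ f c → f , c , refl) λ i ih f (3≤k , inj , adjacent) →
      let open Equivalence
          (g , c , eq) = ih (f ∘ next) (3≤k , next-injective ∘ inj , λ a b → mk⇔
            (Sum.map (from step₀-next) (from step₀-next) ∘ to (adjacent (next a) (next b)))
            (from (adjacent (next a) (next b)) ∘ Sum.map (to step₀-next) (to step₀-next)))
      in g , c , trans eq (cong f (step-unique (next-step (inject₁ i))
                                    (inj₁ (cong suc (Fin.toℕ-inject₁ i)))))

open Rotation using (rotate)

-- Decidability of reachability in G - Ω is taken as a parameter; it is supplied under a double
-- negation once the goal is `⊥`.
module PMC (G : Graph) (Ω : VSet (n G)) (F : BRel (n G))
           (minimal : IsMinimalTriangulation G F) (maximal : IsMaximalClique (G +F F) Ω)
           (conn? : ∀ u v → Dec (Conn (adj G) (λ w → Ω w ≡ false) u v)) where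

  private
    V : Set
    V = Fin (n G)

    H : BRel (n G)
    H = G +F F

  -- For `c` outside Ω, `K c` is the component of G - Ω containing `c`, and `Touch c` holds on Ω
  -- exactly at the boundary of that component.
  K : V → V → Set
  K = Conn (adj G) (λ w → Ω w ≡ false)

  Touch : V → V → Set
  Touch c x = ∃[ d ] (K c d × adj G d x ≡ true)

  touch? : ∀ c x → Dec (Touch c x)
  touch? c x = Fin.any? λ d → conn? c d ×-dec (adj G d x Bool.≟ true)

  K-sym : ∀ {u v} → Ω u ≡ false → K u v → K v u
  K-sym = conn-sym (symm G)

  touch-trans : ∀ {c d x} → K c d → Touch d x → Touch c x
  touch-trans r (e , s , ex) = e , conn-trans r s , ex

  Ω? : ∀ u → Ω u ≡ true ⊎ Ω u ≡ false
  Ω? u with Ω u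
  ... | true  = inj₁ refl
  ... | false = inj₂ refl

  module _ (F : BRel (n G)) (nonEdges : IsNonEdgeSet G F) where

    fill-sym : ∀ u v → (G +F F) u v ≡ (G +F F) v u
    fill-sym u v = cong₂ _∨_ (symm G u v) (proj₁ nonEdges u v)

    fill-irrefl : ∀ u → (G +F F) u u ≡ false
    fill-irrefl u = cong₂ _∨_ (irrefl G u) (proj₁ (proj₂ nonEdges) u)

  private
    nonEdges : IsNonEdgeSet G F
    nonEdges = proj₁ (proj₁ minimal)

    chordal : ChordalRel H
    chordal = proj₂ (proj₁ minimal)

    clique : IsClique H Ω
    clique = proj₁ maximal

  adj⇒H : ∀ {u v} → adj G u v ≡ true → H u v ≡ true
  adj⇒H {u} {v} e = cong (_∨ F u v) e

  module NoFullComponent where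
    open Paths H (fill-sym F nonEdges) (fill-irrefl F nonEdges)

    -- The vertex next to k on a shortest path from k to d through D sees k and all that d sees in Ω.
    common-neighbour : ∀ {c} → Ω c ≡ false → (∀ w → Ω w ≡ true → Touch c w) → ∀ ks →
      ∃[ d ] (K c d × All (λ k → Ω k ≡ true → H d k ≡ true) ks)
    common-neighbour c∉Ω full [] = _ , nil , []
    common-neighbour {c} c∉Ω full (k ∷ ks) with common-neighbour c∉Ω full ks
    ... | d , cd , d-ks with Ω? k
    ...   | inj₂ k∉Ω = d , cd , (λ k∈Ω → ⊥-elim (true≢false k∈Ω k∉Ω)) ∷ d-ks
    ...   | inj₁ k∈Ω with full k k∈Ω
    ...     | e , ce , ek = improve (shortcut k≢d walk)
      where
      k≢d : ¬ k ≡ d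
      k≢d refl = true≢false k∈Ω (conn-target c∉Ω cd)
      walk : Walk (K c) d k
      walk = conn⇒walk (adj⇒H (trans (symm G k e) ek)) ce
               (conn-map adj⇒H (conn-lift ce (conn-trans (K-sym c∉Ω ce) cd)))
      improve : ∃ (PathTo (K c) d k) →
                ∃[ d ] (K c d × All (λ k → Ω k ≡ true → H d k ≡ true) (k ∷ ks))
      improve (u ∷ us , p) = u , All.lookup (pathTo-all cd p) (here refl) ,
          (λ _ → flip-edge (first-edge p)) ∷ All.map other d-ks
        where
        other : ∀ {j} → (Ω j ≡ true → H d j ≡ true) → Ω j ≡ true → H u j ≡ true
        other {j} dj j∈Ω with j Fin.≟ k
        ... | yes refl = flip-edge (first-edge p)
        ... | no  j≢k  = flip-edge (chordal⇒second-adjacent chordal (clique j k j∈Ω k∈Ω j≢k)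
                           (flip-edge (dj j∈Ω))
                           (pathTo-map (λ { cw refl → true≢false j∈Ω (conn-target c∉Ω cw) }) p))

    -- Applied to the list of all vertices, `common-neighbour` yields a vertex outside Ω that sees
    -- all of Ω in `H`, against maximality of the clique.
    not-full : ∀ {c} → Ω c ≡ false → ¬ (∀ w → Ω w ≡ true → Touch c w)
    not-full c∉Ω full with common-neighbour c∉Ω full (allFin (n G))
    ... | d , cd , d-all with proj₂ maximal d (conn-target c∉Ω cd)
    ...   | u , u∈Ω , _ , ud = true≢false (All.lookup d-all (∈-allFin u) u∈Ω) (trans (fill-sym F nonEdges d u) ud)

  open NoFullComponent using (not-full) public

  module Cliquish {x y : V} (x∈Ω : Ω x ≡ true) (y∈Ω : Ω y ≡ true) (x≢y : ¬ x ≡ y)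
                  (xy∉G : adj G x y ≡ false)
                  (separated : ∀ {c} → Ω c ≡ false → Touch c x → Touch c y → ⊥) where

    data IsXY : V → V → Set where
      xy : IsXY x y
      yx : IsXY y x

    isXY? : ∀ u v → Dec (IsXY u v)
    isXY? u v = map′ [ (λ { (refl , refl) → xy }) , (λ { (refl , refl) → yx }) ]′
                     (λ { xy → inj₁ (refl , refl) ; yx → inj₂ (refl , refl) })
                     ((u Fin.≟ x ×-dec v Fin.≟ y) ⊎-dec (u Fin.≟ y ×-dec v Fin.≟ x))

    -- Removing from H the pair xy and all fill edges not kept below leaves a smaller triangulation.
    data Keep (u v : V) : Set where
      inside  : Ω u ≡ true → Ω v ≡ true → ¬ IsXY u v → Keep u v
      outward : Ω u ≡ true → Ω v ≡ false → Touch v u → Keep u v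
      inward  : Ω u ≡ false → Ω v ≡ true → Touch u v → Keep u v
      outside : Ω u ≡ false → Ω v ≡ false → K u v → Keep u v

    keep? : ∀ u v → Dec (Keep u v)
    keep? u v with Ω? u | Ω? v
    ... | inj₁ p | inj₁ q = map′ (inside p q)
      (λ { (inside _ _ r) → r ; (outward _ r _) → ⊥-elim (true≢false q r)
         ; (inward r _ _) → ⊥-elim (true≢false p r) ; (outside r _ _) → ⊥-elim (true≢false p r) })
      (¬? (isXY? u v))
    ... | inj₁ p | inj₂ q = map′ (outward p q)
      (λ { (inside _ r _) → ⊥-elim (true≢false r q) ; (outward _ _ r) → r
         ; (inward r _ _) → ⊥-elim (true≢false p r) ; (outside r _ _) → ⊥-elim (true≢false p r) })
      (touch? v u)
    ... | inj₂ p | inj₁ q = map′ (inward p q)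
      (λ { (inside r _ _) → ⊥-elim (true≢false r p) ; (outward r _ _) → ⊥-elim (true≢false r p)
         ; (inward _ _ r) → r ; (outside _ r _) → ⊥-elim (true≢false q r) })
      (touch? u v)
    ... | inj₂ p | inj₂ q = map′ (outside p q)
      (λ { (inside r _ _) → ⊥-elim (true≢false r p) ; (outward r _ _) → ⊥-elim (true≢false r p)
         ; (inward _ r _) → ⊥-elim (true≢false r q) ; (outside _ _ r) → r })
      (conn? u v)

    keep-sym : ∀ {u v} → Keep u v → Keep v u
    keep-sym (inside p q r)  = inside q p λ { xy → r yx ; yx → r xy }
    keep-sym (outward p q r) = inward q p r
    keep-sym (inward p q r)  = outward q p r
    keep-sym (outside p q r) = outside q p (K-sym p r)

    edge⇒keep : ∀ {u v} → Ω u ≡ false → adj G u v ≡ true → Keep u v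
    edge⇒keep {u} {v} u∉Ω e with Ω? v
    ... | inj₁ v∈Ω = inward u∉Ω v∈Ω (u , nil , e)
    ... | inj₂ v∉Ω = outside u∉Ω v∉Ω (cons e v∉Ω nil)

    F′ : BRel (n G)
    F′ u v = F u v ∧ does (keep? u v)

    H′ : BRel (n G)
    H′ = G +F F′

    nonEdges′ : IsNonEdgeSet G F′
    nonEdges′ =
      (λ u v → cong₂ _∧_ (proj₁ nonEdges u v) (does-⇔ (mk⇔ keep-sym keep-sym) (keep? u v) (keep? v u))) ,
      (λ u → cong (_∧ does (keep? u u)) (proj₁ (proj₂ nonEdges) u)) ,
      (λ u v e → proj₂ (proj₂ nonEdges) u v (Bool.∧-conicalˡ _ _ e))

    kept : ∀ {u v} → Keep u v → H′ u v ≡ H u v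
    kept {u} {v} k = cong (adj G u v ∨_)
      (trans (cong (F u v ∧_) (dec-true (keep? u v) k)) (Bool.∧-identityʳ (F u v)))

    H′-sym : ∀ {u v} → H′ u v ≡ true → H′ v u ≡ true
    H′-sym {u} {v} e = trans (fill-sym F′ nonEdges′ v u) e

    -- Fill edges survive only if kept, and an edge of `G` at a vertex outside Ω leads into its own
    -- component or the boundary. So no edge of `H′` leaves a component other than to its boundary.
    H′⇒keep : ∀ {u v} → Ω u ≡ false → H′ u v ≡ true → Keep u v
    H′⇒keep {u} {v} u∉Ω e with adj G u v in adj-uv
    ... | true  = edge⇒keep u∉Ω adj-uv
    ... | false with keep? u v
    ...   | yes k = k
    ...   | no  _ = ⊥-elim (true≢false e (Bool.∧-zeroʳ (F u v)))

    clique⇒H′ : ∀ {u v} → Ω u ≡ true → Ω v ≡ true → ¬ u ≡ v → ¬ IsXY u v → H′ u v ≡ true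
    clique⇒H′ {u} {v} u∈Ω v∈Ω u≢v ¬xy = trans (kept (inside u∈Ω v∈Ω ¬xy)) (clique u v u∈Ω v∈Ω u≢v)

    -- Two disjoint non-consecutive pairs of the cycle would both be equal to xy.
    cycle-in-Ω : ∀ m f → IsInducedCycle H′ (4 ℕ.+ m) f → (∀ i → Ω (f i) ≡ true) → ⊥
    cycle-in-Ω m f (_ , inj , adjacent) f∈Ω = clash (isXY zero (suc (suc zero)) (λ ()) λ
        { (inj₁ (inj₁ ())) ; (inj₁ (inj₂ (() , _))) ; (inj₂ (inj₁ ())) ; (inj₂ (inj₂ (() , _))) })
      (isXY (suc zero) (suc (suc (suc zero))) (λ ()) λ
        { (inj₁ (inj₁ ())) ; (inj₁ (inj₂ (() , _))) ; (inj₂ (inj₁ ())) ; (inj₂ (inj₂ (_ , ()))) })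
      (λ eq → 0≢1 (inj eq)) (λ eq → 0≢3 (inj eq))
      where
      0≢1 : ¬ zero ≡ suc {n = 3 ℕ.+ m} zero
      0≢1 ()
      0≢3 : ¬ zero ≡ suc {n = 3 ℕ.+ m} (suc (suc zero))
      0≢3 ()
      isXY : ∀ i j → ¬ i ≡ j → ¬ CycStep i j → IsXY (f i) (f j)
      isXY i j i≢j ¬step = decidable-stable (isXY? (f i) (f j)) λ ¬xy →
        ¬step (Equivalence.to (adjacent i j) (clique⇒H′ (f∈Ω i) (f∈Ω j) (i≢j ∘ inj) ¬xy))
      clash : ∀ {a b c d} → IsXY a c → IsXY b d → ¬ a ≡ b → ¬ a ≡ d → ⊥
      clash xy xy a≢b _ = a≢b refl
      clash xy yx _ a≢d = a≢d refl
      clash yx xy _ a≢d = a≢d refl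
      clash yx yx a≢b _ = a≢b refl

    -- A cycle through a component D of G − Ω stays in D ∪ N(D), as N(D) is a clique of H′ separating D.
    module Through {m} {g : Fin (suc m) → V} (cycle : IsInducedCycle H′ (suc m) g)
                   (d∉Ω : Ω (g zero) ≡ false) where

      private
        adjacent : ∀ i j → (H′ (g i) (g j) ≡ true) ⇔ CycStep i j
        adjacent = proj₂ (proj₂ cycle)

      InD ND Near : V → Set
      InD v  = Ω v ≡ false × K (g zero) v
      ND v   = Ω v ≡ true × Touch (g zero) v
      Near v = InD v ⊎ ND v

      near? : ∀ v → Dec (Near v)
      near? v = (Ω v Bool.≟ false ×-dec conn? (g zero) v) ⊎-dec (Ω v Bool.≟ true ×-dec touch? (g zero) v)

      -- Hence `H′` agrees with `H` on the component together with its boundary. The removed pair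
      -- cannot occur there, since by `separated` no component touches both `x` and `y`.
      near-keep : ∀ {u v} → Near u → Near v → Keep u v
      near-keep (inj₁ (u∉Ω , du)) (inj₁ (v∉Ω , dv)) = outside u∉Ω v∉Ω (conn-trans (K-sym d∉Ω du) dv)
      near-keep (inj₁ (u∉Ω , du)) (inj₂ (v∈Ω , dv)) = inward u∉Ω v∈Ω (touch-trans (K-sym d∉Ω du) dv)
      near-keep (inj₂ (u∈Ω , du)) (inj₁ (v∉Ω , dv)) = outward u∈Ω v∉Ω (touch-trans (K-sym d∉Ω dv) du)
      near-keep (inj₂ (u∈Ω , du)) (inj₂ (v∈Ω , dv)) =
        inside u∈Ω v∈Ω λ { xy → separated d∉Ω du dv ; yx → separated d∉Ω dv du }

      near-closed : ∀ {u v} → InD u → H′ u v ≡ true → Near v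
      near-closed (u∉Ω , du) e with H′⇒keep u∉Ω e
      ... | inside u∈Ω _ _    = ⊥-elim (true≢false u∈Ω u∉Ω)
      ... | outward u∈Ω _ _   = ⊥-elim (true≢false u∈Ω u∉Ω)
      ... | inward _ v∈Ω t    = inj₂ (v∈Ω , touch-trans du t)
      ... | outside _ v∉Ω uv = inj₁ (v∉Ω , conn-trans du uv)

      start : InD (g zero)
      start = d∉Ω , nil

      consecutive : ∀ {i j} → CycStep i j → H′ (g i) (g j) ≡ true
      consecutive {i} {j} = Equivalence.from (adjacent i j)

      inject-step : ∀ (i : Fin m) → CycStep (inject₁ i) (suc i)
      inject-step i = inj₁ (inj₁ (cong suc (Fin.toℕ-inject₁ i)))

      -- Going back from `l`, the first near vertex met has a neighbour that is not near, so by
      -- `near-closed` it is in the boundary. Its index is positive because `g zero` is outside Ω.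
      below : ∀ l → ¬ Near (g l) → ∃[ i ] (0 ℕ.< toℕ i × toℕ i ℕ.< toℕ l × ND (g i))
      below = <-weakInduction _ (λ far → ⊥-elim (far (inj₁ start))) advance
        where
        advance : ∀ i → (¬ Near (g (inject₁ i)) → ∃[ j ] (0 ℕ.< toℕ j × toℕ j ℕ.< toℕ (inject₁ i) × ND (g j))) →
                  ¬ Near (g (suc i)) → ∃[ j ] (0 ℕ.< toℕ j × toℕ j ℕ.< toℕ (suc i) × ND (g j))
        advance i ih far with near? (g (inject₁ i))
        ... | yes (inj₁ p) = ⊥-elim (far (near-closed p (consecutive (inject-step i))))
        ... | yes (inj₂ p) = inject₁ i , positive i (proj₁ p) , ℕ.≤-reflexive (cong suc (Fin.toℕ-inject₁ i)) , p
          where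
          positive : ∀ i → Ω (g (inject₁ i)) ≡ true → 0 ℕ.< toℕ (inject₁ i)
          positive zero    0∈Ω = ⊥-elim (true≢false 0∈Ω d∉Ω)
          positive (suc _) _   = s≤s z≤n
        ... | no far′ with ih far′
        ...   | j , 0<j , j<i , p =
          j , 0<j , ℕ.m<n⇒m<1+n (subst (toℕ j ℕ.<_) (Fin.toℕ-inject₁ i) j<i) , p

      above : ∀ l → ¬ Near (g l) → ∃[ j ] (toℕ l ℕ.< toℕ j × ND (g j))
      above = >-weakInduction _
        -- The last position is cyclically adjacent to `zero`, whose vertex lies in the component,
        -- so the last vertex is near.
        (λ far → ⊥-elim (far (near-closed start (consecutive
                   (inj₂ (inj₂ (cong suc (Fin.toℕ-fromℕ m) , refl))))))) advance
        where
        advance : ∀ i → (¬ Near (g (suc i)) → ∃[ j ] (toℕ (suc i) ℕ.< toℕ j × ND (g j))) →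
                  ¬ Near (g (inject₁ i)) → ∃[ j ] (toℕ (inject₁ i) ℕ.< toℕ j × ND (g j))
        advance i ih far with near? (g (suc i))
        ... | yes (inj₁ p) = ⊥-elim (far (near-closed p (H′-sym (consecutive (inject-step i)))))
        ... | yes (inj₂ p) = suc i , ℕ.≤-reflexive (cong suc (Fin.toℕ-inject₁ i)) , p
        ... | no far′ with ih far′
        ...   | j , i<j , p = j , ℕ.<-trans (ℕ.≤-reflexive (cong suc (Fin.toℕ-inject₁ i))) i<j , p

      -- Position `l` blocks one arc between `i` and `j`, and position `zero` blocks the other.
      separated-steps : ∀ {i l j : Fin (suc m)} → 0 ℕ.< toℕ i → toℕ i ℕ.< toℕ l → toℕ l ℕ.< toℕ j → ¬ CycStep i j
      separated-steps 0<i i<l l<j (inj₁ (inj₁ eq)) =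
        ℕ.<⇒≢ (ℕ.≤-<-trans i<l l<j) eq
      separated-steps 0<i i<l l<j (inj₁ (inj₂ (_ , eq))) =
        ℕ.<⇒≢ (ℕ.≤-<-trans z≤n l<j) (sym eq)
      separated-steps 0<i i<l l<j (inj₂ (inj₁ eq)) =
        ℕ.<⇒≢ (ℕ.m<n⇒m<1+n (ℕ.<-trans i<l l<j)) (sym eq)
      separated-steps 0<i i<l l<j (inj₂ (inj₂ (_ , eq))) = ℕ.<⇒≢ 0<i (sym eq)

      -- If the whole cycle is near, it is an induced cycle of the chordal graph `H`. Otherwise a
      -- vertex that is not near has boundary vertices on both sides, and these are joined by a
      -- chord because the boundary is a clique of `H′`.
      triangle : suc m ≡ 3
      triangle with Fin.any? (¬? ∘ near? ∘ g)
      ... | no none = chordal (suc m) g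
        (proj₁ cycle , proj₁ (proj₂ cycle) , λ i j → subst (λ b → (b ≡ true) ⇔ CycStep i j)
          (kept (near-keep (near i) (near j))) (adjacent i j))
        where
        near : ∀ i → Near (g i)
        near i = decidable-stable (near? (g i)) λ far → none (i , far)
      ... | yes (l , far) with below l far | above l far
      ...   | i , 0<i , i<l , p | j , l<j , q = ⊥-elim (separated-steps {i} {l} {j} 0<i i<l l<j
        (Equivalence.to (adjacent i j) (trans (kept (near-keep (inj₂ p) (inj₂ q)))
          (clique (g i) (g j) (proj₁ p) (proj₁ q)
            λ eq → ℕ.<⇒≢ (ℕ.<-trans i<l l<j) (cong toℕ (proj₁ (proj₂ cycle) eq))))))

    chordal′ : ChordalRel H′
    chordal′ (suc zero) f (s≤s () , _)
    chordal′ (suc (suc zero)) f (s≤s (s≤s ()) , _)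
    chordal′ 3 f _ = refl
    chordal′ (suc (suc (suc (suc m)))) f cycle with Fin.any? (λ i → Ω (f i) Bool.≟ false)
    ... | yes (i , fi∉Ω) with rotate {A = H′} i f cycle
    ...   | g , cycle′ , eq = Through.triangle cycle′ (trans (cong Ω eq) fi∉Ω)
    chordal′ (suc (suc (suc (suc m)))) f cycle | no none =
      ⊥-elim (cycle-in-Ω m f cycle λ i → [ id , (λ p → ⊥-elim (none (i , p))) ]′ (Ω? (f i)))

    -- The pair `xy` is a fill edge, as Ω is a clique of `H` but `x` and `y` are nonadjacent in `G`;
    -- `Keep` rejects it. So `F′` is a strictly smaller triangulation, against minimality of `F`.
    not-separated : ⊥
    not-separated = proj₂ minimal F′
      ((λ u v → Bool.∧-conicalˡ _ _) , x , y , xy∈F , xy∉F′) (nonEdges′ , chordal′)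
      where
      xy∈F : F x y ≡ true
      xy∈F = trans (sym (cong (_∨ F x y) xy∉G)) (clique x y x∈Ω y∈Ω x≢y)
      xy∉F′ : F′ x y ≡ false
      xy∉F′ = trans (cong (F x y ∧_) (dec-false (keep? x y) λ
        { (inside _ _ ¬xy) → ¬xy xy ; (outward _ r _) → true≢false y∈Ω r
        ; (inward r _ _) → true≢false x∈Ω r ; (outside r _ _) → true≢false x∈Ω r }))
        (Bool.∧-zeroʳ (F x y))

  cliquish : ∀ {x y} → Ω x ≡ true → Ω y ≡ true → ¬ x ≡ y → adj G x y ≡ false →
             ∃[ c ] (Ω c ≡ false × Touch c x × Touch c y)
  cliquish {x} {y} x∈Ω y∈Ω x≢y xy∉G = decidable-stable
    (Fin.any? λ c → Ω c Bool.≟ false ×-dec touch? c x ×-dec touch? c y)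
    λ none → Cliquish.not-separated x∈Ω y∈Ω x≢y xy∉G λ c∉Ω cx cy → none (_ , c∉Ω , cx , cy)

-- Weighted choices

sum-cong : ∀ {n} {f g : Fin n → ℚ} → (∀ i → f i ≡ g i) → sumFin f ≡ sumFin g
sum-cong {zero}  eq = refl
sum-cong {suc n} eq = cong₂ _+_ (eq zero) (sum-cong (eq ∘ suc))

sum-mono : ∀ {n} {f g : Fin n → ℚ} → (∀ i → f i ≤ℚ g i) → sumFin f ≤ℚ sumFin g
sum-mono {zero}  le = ℚ.≤-refl
sum-mono {suc n} le = ℚ.+-mono-≤ (le zero) (sum-mono (le ∘ suc))

sum-0 : ∀ n → sumFin {n} (λ _ → 0ℚ) ≡ 0ℚ
sum-0 zero    = refl
sum-0 (suc n) = trans (ℚ.+-identityˡ _) (sum-0 n)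

+-interchange : ∀ a b c d → (a + b) + (c + d) ≡ (a + c) + (b + d)
+-interchange a b c d = begin
  (a + b) + (c + d)  ≡⟨ ℚ.+-assoc a b (c + d) ⟩
  a + (b + (c + d))  ≡⟨ cong (λ t → a + t) (sym (ℚ.+-assoc b c d)) ⟩
  a + ((b + c) + d)  ≡⟨ cong (λ t → a + (t + d)) (ℚ.+-comm b c) ⟩
  a + ((c + b) + d)  ≡⟨ cong (λ t → a + t) (ℚ.+-assoc c b d) ⟩
  a + (c + (b + d))  ≡⟨ ℚ.+-assoc a c (b + d) ⟨
  (a + c) + (b + d)  ∎
  where open ≡-Reasoning

sum-+ : ∀ {n} (f g : Fin n → ℚ) → sumFin (λ i → f i + g i) ≡ sumFin f + sumFin g
sum-+ {zero}  f g = refl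
sum-+ {suc n} f g = trans (cong (λ t → (f zero + g zero) + t) (sum-+ (f ∘ suc) (g ∘ suc)))
                          (+-interchange (f zero) (g zero) _ _)

sum-* : ∀ {n} c (f : Fin n → ℚ) → sumFin (λ i → c * f i) ≡ c * sumFin f
sum-* {zero}  c f = sym (ℚ.*-zeroʳ c)
sum-* {suc n} c f = trans (cong (λ t → c * f zero + t) (sum-* c (f ∘ suc)))
                          (sym (ℚ.*-distribˡ-+ c (f zero) _))

sum-swap : ∀ {m n} (f : Fin m → Fin n → ℚ) →
           sumFin (λ i → sumFin (f i)) ≡ sumFin (λ j → sumFin (λ i → f i j))
sum-swap {zero}  {n} f = sym (sum-0 n)
sum-swap {suc m} {n} f = trans (cong (λ t → sumFin (f zero) + t) (sum-swap (f ∘ suc)))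
                               (sym (sum-+ (f zero) _))

not-true⇒false : ∀ {b} → not b ≡ true → b ≡ false
not-true⇒false {false} _ = refl

∨-true : ∀ a {b} → a ∨ b ≡ true → a ≡ true ⊎ b ≡ true
∨-true true  _ = inj₁ refl
∨-true false e = inj₂ e

∨-false : ∀ a {b} → a ∨ b ≡ false → a ≡ false × b ≡ false
∨-false false e = refl , e

indicator : Bool → ℚ
indicator b = if b then 1ℚ else 0ℚ

indicator-nonneg : ∀ b → 0ℚ ≤ℚ indicator b
indicator-nonneg true  = from-yes (0ℚ ≤ℚ? 1ℚ)
indicator-nonneg false = ℚ.≤-refl

times : ℕ → ℚ → ℚ
times zero    q = 0ℚ
times (suc k) q = q + times k q

-- ε = 11 · 2β bounds the mass near the at most 11 vertices of an anchored support, κ an in-mass after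
-- a Markov choice, γ the boundary of a small component, and η the mass lost by the choice of two roots.
abstract
  β ε κ γ ½γ ¼γ η : ℚ
  η  = + 7 / 40
  β  = + 1 / 2200000
  ε  = + 1 / 100000
  κ  = + 1 / 500
  γ  = + 1 / 40
  ½γ = + 1 / 80
  ¼γ = + 1 / 160

  0<β : 0ℚ < β
  0<β = from-yes (0ℚ <? β)

  0≤κ : 0ℚ ≤ℚ κ
  0≤κ = from-yes (0ℚ ≤ℚ? κ)

  0≤¼γ : 0ℚ ≤ℚ ¼γ
  0≤¼γ = from-yes (0ℚ ≤ℚ? ¼γ)

  ¼γ+¼γ≤½γ : ¼γ + ¼γ ≤ℚ ½γ
  ¼γ+¼γ≤½γ = from-yes (¼γ + ¼γ ≤ℚ? ½γ)

  ε<κ¼γ : ε < κ * ¼γ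
  ε<κ¼γ = from-yes (ε <? κ * ¼γ)

  ε+κ≤¼γ : ε + κ ≤ℚ ¼γ
  ε+κ≤¼γ = from-yes (ε + κ ≤ℚ? ¼γ)

  11[2β]≤ε : times 11 (β + β) ≤ℚ ε
  11[2β]≤ε = from-yes (times 11 (β + β) ≤ℚ? ε)

  0≤2β : 0ℚ ≤ℚ β + β
  0≤2β = from-yes (0ℚ ≤ℚ? β + β)

  ½γ+2β≤γ : ½γ + (β + β) ≤ℚ γ
  ½γ+2β≤γ = from-yes (½γ + (β + β) ≤ℚ? γ)

  0≤γ : 0ℚ ≤ℚ γ
  0≤γ = from-yes (0ℚ ≤ℚ? γ)

  0≤2γ : 0ℚ ≤ℚ γ + γ
  0≤2γ = from-yes (0ℚ ≤ℚ? γ + γ)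

  γ<2γ : γ < (γ + γ) * 1ℚ
  γ<2γ = from-yes (γ <? (γ + γ) * 1ℚ)

  0≤η : 0ℚ ≤ℚ η
  0≤η = from-yes (0ℚ ≤ℚ? η)

  3γ<η½ : (γ + γ) + γ < η * ½
  3γ<η½ = from-yes ((γ + γ) + γ <? η * ½)

  ½+2β≤1 : ½ + (β + β) ≤ℚ 1ℚ
  ½+2β≤1 = from-yes (½ + (β + β) ≤ℚ? 1ℚ)

  ½γ+4β+η≤1 : ½γ + ((β + β) + ((β + β) + η)) ≤ℚ 1ℚ
  ½γ+4β+η≤1 = from-yes (½γ + ((β + β) + ((β + β) + η)) ≤ℚ? 1ℚ)

  2[ε+κ]≤¼γ : (ε + κ) + (ε + κ) ≤ℚ ¼γ
  2[ε+κ]≤¼γ = from-yes ((ε + κ) + (ε + κ) ≤ℚ? ¼γ)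

module Measure {n : ℕ} (ν : Fin n → ℚ) (ν-nonneg : ∀ u → 0ℚ ≤ℚ ν u)
               (ν-total : sumFin ν ≡ 1ℚ) where

  ∫ : (Fin n → ℚ) → ℚ
  ∫ f = sumFin (λ u → ν u * f u)

  mass : VSet n → ℚ
  mass S = ∫ (indicator ∘ S)

  ∫-mono : ∀ {f g} → (∀ u → f u ≤ℚ g u) → ∫ f ≤ℚ ∫ g
  ∫-mono le = sum-mono λ u → ℚ.*-monoˡ-≤-nonNeg (ν u) {{nonNegative (ν-nonneg u)}} (le u)

  ∫-cong : ∀ {f g} → (∀ u → f u ≡ g u) → ∫ f ≡ ∫ g
  ∫-cong eq = sum-cong λ u → cong (ν u *_) (eq u)

  ∫-+ : ∀ f g → ∫ (λ u → f u + g u) ≡ ∫ f + ∫ g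
  ∫-+ f g = trans (sum-cong λ u → ℚ.*-distribˡ-+ (ν u) (f u) (g u)) (sum-+ {n} _ _)

  ∫-* : ∀ c f → ∫ (λ u → c * f u) ≡ c * ∫ f
  ∫-* c f = trans (sum-cong λ u → begin
    ν u * (c * f u)  ≡⟨ ℚ.*-assoc (ν u) c (f u) ⟨
    (ν u * c) * f u  ≡⟨ cong (_* f u) (ℚ.*-comm (ν u) c) ⟩
    (c * ν u) * f u  ≡⟨ ℚ.*-assoc c (ν u) (f u) ⟩
    c * (ν u * f u)  ∎) (sum-* {n} c _)
    where open ≡-Reasoning

  ∫-const : ∀ c → ∫ (λ _ → c) ≡ c
  ∫-const c = begin
    sumFin (λ u → ν u * c)  ≡⟨ sum-cong (λ u → ℚ.*-comm (ν u) c) ⟩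
    sumFin (λ u → c * ν u)  ≡⟨ sum-* {n} c ν ⟩
    c * sumFin ν            ≡⟨ cong (c *_) ν-total ⟩
    c * 1ℚ                  ≡⟨ ℚ.*-identityʳ c ⟩
    c                       ∎
    where open ≡-Reasoning

  ∫-≤ : ∀ {f c} → (∀ u → f u ≤ℚ c) → ∫ f ≤ℚ c
  ∫-≤ {f} {c} le = ℚ.≤-trans (∫-mono le) (ℚ.≤-reflexive (∫-const c))

  ∫-swap : ∀ (f : Fin n → Fin n → ℚ) → ∫ (λ x → ∫ (λ y → f x y)) ≡ ∫ (λ y → ∫ (λ x → f x y))
  ∫-swap f = begin
    sumFin (λ x → ν x * sumFin (λ y → ν y * f x y))    ≡⟨ sum-cong (λ x → sum-* {n} (ν x) (λ y → ν y * f x y)) ⟨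
    sumFin (λ x → sumFin (λ y → ν x * (ν y * f x y)))  ≡⟨ sum-swap {n} {n} (λ x y → ν x * (ν y * f x y)) ⟩
    sumFin (λ y → sumFin (λ x → ν x * (ν y * f x y)))  ≡⟨ sum-cong (λ y → ∫-* (ν y) (λ x → f x y)) ⟩
    sumFin (λ y → ν y * sumFin (λ x → ν x * f x y))    ∎
    where open ≡-Reasoning

  mass-∪ : ∀ {S T U} → (∀ u → S u ≡ true → T u ≡ true ⊎ U u ≡ true) → mass S ≤ℚ mass T + mass U
  mass-∪ {S} {T} {U} cover = ℚ.≤-trans (∫-mono pointwise) (ℚ.≤-reflexive (∫-+ _ _))
    where
    bound : ∀ s t u → (s ≡ true → t ≡ true ⊎ u ≡ true) → indicator s ≤ℚ indicator t + indicator u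
    bound false t     u     _ = ℚ.+-mono-≤ (indicator-nonneg t) (indicator-nonneg u)
    bound true  true  true  _ = from-yes (1ℚ ≤ℚ? 1ℚ + 1ℚ)
    bound true  true  false _ = from-yes (1ℚ ≤ℚ? 1ℚ + 0ℚ)
    bound true  false true  _ = from-yes (1ℚ ≤ℚ? 0ℚ + 1ℚ)
    bound true  false false c with c refl
    ... | inj₁ ()
    ... | inj₂ ()
    pointwise : ∀ u → indicator (S u) ≤ℚ indicator (T u) + indicator (U u)
    pointwise u = bound (S u) (T u) (U u) (cover u)

  mass-mono : ∀ {S T} → (∀ u → S u ≡ true → T u ≡ true) → mass S ≤ℚ mass T
  mass-mono {S} {T} sub = ∫-mono λ u → bound (S u) (T u) (sub u)
    where
    bound : ∀ s t → (s ≡ true → t ≡ true) → indicator s ≤ℚ indicator t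
    bound false t     _ = indicator-nonneg t
    bound true  true  _ = ℚ.≤-refl
    bound true  false c with c refl
    ... | ()

  mass-∅ : ∀ {S} → (∀ u → S u ≡ false) → mass S ≡ 0ℚ
  mass-∅ none = trans (sum-cong λ u → trans (cong (λ b → ν u * indicator b) (none u)) (ℚ.*-zeroʳ (ν u)))
                      (sum-0 n)

  ∫-nonneg : ∀ {f} → (∀ u → 0ℚ ≤ℚ f u) → 0ℚ ≤ℚ ∫ f
  ∫-nonneg f≥0 = ℚ.≤-trans (ℚ.≤-reflexive (sym (∫-const 0ℚ))) (∫-mono f≥0)

  mass-nonneg : ∀ S → 0ℚ ≤ℚ mass S
  mass-nonneg S = ∫-nonneg λ u → indicator-nonneg (S u)

  -- This is subadditivity without subtraction: the numerical loss is passed as `t + b ≤ s`, ready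
  -- for the constant inequalities above.
  mass-∖ : ∀ {S B s b t} → s ≤ℚ mass S → mass B ≤ℚ b → t + b ≤ℚ s → t ≤ℚ mass (λ u → S u ∧ not (B u))
  mass-∖ {S} {B} {s} {b} {t} s≤S B≤b t+b≤s = ℚ.≮⇒≥ λ small → ℚ.<-irrefl refl (begin-strict
    mass S                                ≤⟨ mass-∪ {S} {λ u → S u ∧ not (B u)} {B} (λ u → split (S u) (B u)) ⟩
    mass (λ u → S u ∧ not (B u)) + mass B  <⟨ ℚ.+-mono-<-≤ small B≤b ⟩
    t + b                                 ≤⟨ t+b≤s ⟩
    s                                     ≤⟨ s≤S ⟩
    mass S                                ∎)
    where
    open ℚ.≤-Reasoning
    split : ∀ x b → x ≡ true → x ∧ not b ≡ true ⊎ b ≡ true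
    split true true  _ = inj₂ refl
    split true false _ = inj₁ refl

  -- If `g` exceeded `k` on all of `S`, its integral would be at least `k * mass S`, hence more than
  -- `d`.
  markov : ∀ {g S k s d} → (∀ u → 0ℚ ≤ℚ g u) → ∫ g ≤ℚ d → s ≤ℚ mass S → 0ℚ ≤ℚ k → d < k * s →
           ∃[ z ] (S z ≡ true × g z ≤ℚ k)
  markov {g} {S} {k} {s} {d} g≥0 ∫g≤d s≤S k≥0 d<ks = decidable-stable
    (Fin.any? λ z → (S z Bool.≟ true) ×-dec (g z ≤ℚ? k)) λ none →
    ℚ.<-irrefl refl (begin-strict
      d                               <⟨ d<ks ⟩
      k * s                           ≤⟨ ℚ.*-monoˡ-≤-nonNeg k {{nonNegative k≥0}} s≤S ⟩
      k * mass S                      ≡⟨ ∫-* k (indicator ∘ S) ⟨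
      ∫ (λ u → k * indicator (S u))   ≤⟨ ∫-mono (λ u → bound none u (S u) refl) ⟩
      ∫ g                             ≤⟨ ∫g≤d ⟩
      d                               ∎)
    where
    open ℚ.≤-Reasoning
    bound : ¬ (∃[ z ] (S z ≡ true × g z ≤ℚ k)) → ∀ u b → S u ≡ b → k * indicator b ≤ℚ g u
    bound none u false _ = ℚ.≤-trans (ℚ.≤-reflexive (ℚ.*-zeroʳ k)) (g≥0 u)
    bound none u true  e = ℚ.≤-trans (ℚ.≤-reflexive (ℚ.*-identityʳ k))
                             (ℚ.<⇒≤ (ℚ.≰⇒> λ le → none (u , e , le)))

  module _ {R : Fin n → Fin n → Bool} (out : ∀ x → mass (R x) ≤ℚ ε)
           {X : VSet n} (X-large : ½γ ≤ℚ mass X) where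

    private
      -- Read `R` as a digraph. Out-masses are bounded at every vertex, whereas in-masses are
      -- bounded only on average, by exchanging the integrals; `pick` therefore selects vertices of
      -- small in-mass by Markov.
      inMass : Fin n → ℚ
      inMass z = mass (λ x → R x z)

      ∫-inMass : ∫ inMass ≤ℚ ε
      ∫-inMass = ℚ.≤-trans (ℚ.≤-reflexive (∫-swap λ z x → indicator (R x z))) (∫-≤ out)

      pick : ∀ (B : VSet n) → mass B ≤ℚ ¼γ → ∃[ z ] (X z ≡ true × B z ≡ false × inMass z ≤ℚ κ)
      pick B B-small with markov {g = inMass} {S = λ u → X u ∧ not (B u)} (λ _ → mass-nonneg _)
                            ∫-inMass (mass-∖ {X} {B} X-large B-small ¼γ+¼γ≤½γ) 0≤κ ε<κ¼γ
      ... | z , z∈S , le = z , Bool.∧-conicalˡ _ _ z∈S , not-true⇒false (Bool.∧-conicalʳ (X z) _ z∈S) , le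

      Conflict : Fin n → VSet n
      Conflict x z = R x z ∨ R z x

      conflict-mass : ∀ {x} → inMass x ≤ℚ κ → mass (Conflict x) ≤ℚ ε + κ
      conflict-mass {x} in-x = ℚ.≤-trans
        (mass-∪ {Conflict x} {R x} {λ z → R z x} λ u → ∨-true (R x u)) (ℚ.+-mono-≤ (out x) in-x)

      conflicts-mass : ∀ {x y} → inMass x ≤ℚ κ → inMass y ≤ℚ κ →
                       mass (λ z → Conflict x z ∨ Conflict y z) ≤ℚ ¼γ
      conflicts-mass {x} {y} in-x in-y = ℚ.≤-trans
        (mass-∪ {λ z → Conflict x z ∨ Conflict y z} {Conflict x} {Conflict y} λ u → ∨-true (Conflict x u))
        (ℚ.≤-trans (ℚ.+-mono-≤ (conflict-mass in-x) (conflict-mass in-y)) 2[ε+κ]≤¼γ)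

    Compatible : Fin n → Fin n → Set
    Compatible x y = R x y ≡ false × R y x ≡ false

    -- A greedy choice: a picked vertex conflicts with mass at most `ε + κ`, so even two of them
    -- rule out at most `¼γ`, half of what `X` is known to have.
    independent-triple : ∃[ x ] ∃[ y ] ∃[ z ] (X x ≡ true × X y ≡ true × X z ≡ true ×
                         Compatible x y × Compatible x z × Compatible y z)
    independent-triple =
      let x , x∈X , _ , in-x = pick (λ _ → false)
            (ℚ.≤-trans (ℚ.≤-reflexive (mass-∅ {λ _ → false} λ _ → refl)) 0≤¼γ)
          y , y∈X , xy , in-y = pick (Conflict x) (ℚ.≤-trans (conflict-mass in-x) ε+κ≤¼γ)
          z , z∈X , xyz , _ = pick (λ u → Conflict x u ∨ Conflict y u) (conflicts-mass in-x in-y)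
          xz , yz = ∨-false (Conflict x z) xyz
      in x , y , z , x∈X , y∈X , z∈X , ∨-false (R x y) xy , ∨-false (R x z) xz , ∨-false (R y z) yz

-- Anchored sets

module Bridges (G : Graph) where
  open Paths (adj G) (symm G) (irrefl G) public

  private
    V : Set
    V = Fin (n G)

  Clear : List V → V → Set
  Clear os z = All (λ o → Apart o z) os

  apart-sym : ∀ {u v} → Apart u v → Apart v u
  apart-sym {u} {v} (u≢v , uv) = u≢v ∘ sym , trans (symm G v u) uv

  -- A common neighbour of x and y on one of the paths would contradict the clearness of the other end.
  bridge : ∀ {P c x y ps qs} → PathTo P c x ps → PathTo P c y qs →
           Apart x y → Clear ps y → Clear qs x →
           ∃[ L ] (PathTo (λ v → v ∈ ps ⊎ v ∈ qs) y x L × 3 ≤ length L)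
  bridge {x = x} {y} {ps} {qs} p q (x≢y , xy) ps-y qs-x = L , r , long r
    where
    route : ∃ (PathTo (λ v → v ∈ ps ⊎ v ∈ qs) y x)
    route = shortcut x≢y (walk-trans (walk-map inj₁ (pathTo⇒walk p)) (inj₁ (pathTo-end p))
                           (walk-reverse (walk-map inj₂ (pathTo⇒walk q))))
    L : List V
    L = proj₁ route
    r : PathTo (λ v → v ∈ ps ⊎ v ∈ qs) y x L
    r = proj₂ route
    long : ∀ {L} → PathTo (λ v → v ∈ ps ⊎ v ∈ qs) y x L → 3 ≤ length L
    long (edge e)                          = ⊥-elim (true≢false e xy)
    long (cons _ (inj₁ v∈ps) _ (edge vy))  = ⊥-elim (true≢false vy (proj₂ (All.lookup ps-y v∈ps)))
    long (cons xv (inj₂ v∈qs) _ (edge _))  =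
      ⊥-elim (true≢false (flip-edge xv) (proj₂ (All.lookup qs-x v∈qs)))
    long (cons _ _ _ (cons _ _ _ (edge _)))       = s≤s (s≤s (s≤s z≤n))
    long (cons _ _ _ (cons _ _ _ (cons _ _ _ _))) = s≤s (s≤s (s≤s z≤n))

  record Anchored (D E : V → Set) (c w x : V) : Set where
    field
      {ps qs} : List V
      toC : PathTo D c x ps
      toW : PathTo E w x qs

    support : List V
    support = x ∷ ps ++ qs

    clear-split : ∀ {z} → Clear support z → Apart x z × Clear ps z × Clear qs z
    clear-split (xz ∷ clear) = xz , All.++⁻ ps clear

  open Anchored

  -- The first bridge runs from `x` to `y` through `D`, the second from `y` to `z` through `E`.
  -- Their interiors do not see each other by `anti`; clearness of the supports keeps `x` away from
  -- the second bridge and `z` away from the first. The six or more edges give an induced path on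
  -- seven vertices.
  two-bridges : P7Free G → ∀ {D E c w} → D c → E w → (∀ {d e} → D d → E e → Apart d e) →
    ∀ {x y z} (X : Anchored D E c w x) (Y : Anchored D E c w y) (Z : Anchored D E c w z) →
    Clear (support X) y → Clear (support Y) x → Clear (support X) z → Clear (support Z) x →
    Clear (support Y) z → Clear (support Z) y → ⊥
  two-bridges p7free {D} {E} Dc Ew anti {x} {y} {z} X Y Z Xy Yx Xz Zx Yz Zy
    with clear-split X Xy | clear-split Y Yx | clear-split X Xz | clear-split Z Zx
       | clear-split Y Yz | clear-split Z Zy
  ... | xy , Xy-ps , _ | _ , Yx-ps , Yx-qs | xz , Xz-ps , _ | _ , _ , Zx-qs
      | yz , Yz-ps , Yz-qs | _ , _ , Zy-qs
    with bridge (toC X) (toC Y) xy Xy-ps Yx-ps | bridge (toW Y) (toW Z) yz Yz-qs Zy-qs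
  ...   | L , p , 3≤L | M , q , 3≤M = p7free (long⇒P7
          (induced-++ p (pathTo⇒induced q) (All.map from-x M-vertices) λ v → All.map (from-D v) M-vertices)
          (ℕ.≤-trans (ℕ.+-mono-≤ 3≤L 3≤M) (ℕ.≤-reflexive (sym (List.length-++ L)))))
    where
    M-vertices : All (λ v → (v ∈ qs Y ⊎ v ∈ qs Z) ⊎ v ≡ z) M
    M-vertices = pathTo-all (inj₂ refl) (pathTo-map inj₁ q)
    from-x : ∀ {v} → (v ∈ qs Y ⊎ v ∈ qs Z) ⊎ v ≡ z → Apart x v
    from-x (inj₁ (inj₁ v∈Y)) = apart-sym (All.lookup Yx-qs v∈Y)
    from-x (inj₁ (inj₂ v∈Z)) = apart-sym (All.lookup Zx-qs v∈Z)
    from-x (inj₂ refl)       = xz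
    in-D : ∀ {v} → v ∈ ps X ⊎ v ∈ ps Y → D v
    in-D = [ All.lookup (pathTo-all Dc (toC X)) , All.lookup (pathTo-all Dc (toC Y)) ]′
    from-D : ∀ {u} → u ∈ ps X ⊎ u ∈ ps Y → ∀ {v} → (v ∈ qs Y ⊎ v ∈ qs Z) ⊎ v ≡ z → Apart u v
    from-D u (inj₁ (inj₁ v∈Y)) = anti (in-D u) (All.lookup (pathTo-all Ew (toW Y)) v∈Y)
    from-D u (inj₁ (inj₂ v∈Z)) = anti (in-D u) (All.lookup (pathTo-all Ew (toW Z)) v∈Z)
    from-D (inj₁ u∈X) (inj₂ refl) = All.lookup Xz-ps u∈X
    from-D (inj₂ u∈Y) (inj₂ refl) = All.lookup Yz-ps u∈Y

  length≤5 : P7Free G → ∀ {P t u vs} → PathTo P t u vs → length vs ≤ 5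
  length≤5 p7free p = ℕ.≤-pred (ℕ.≰⇒> (p7free ∘ long⇒P7 (pathTo⇒induced p)))

  -- The count is `x` itself plus at most five further vertices on each of the two induced paths.
  support-length : P7Free G → ∀ {D E c w x} (X : Anchored D E c w x) → length (support X) ≤ 11
  support-length p7free X = s≤s (ℕ.≤-trans (ℕ.≤-reflexive (List.length-++ (ps X)))
    (ℕ.+-mono-≤ (length≤5 p7free (toC X)) (length≤5 p7free (toW X))))

  closedNbhd : V → VSet (n G)
  closedNbhd o z = does (o Fin.≟ z) ∨ adj G o z

  closedNbhd-apart : ∀ {o z} → closedNbhd o z ≡ false → Apart o z
  closedNbhd-apart {o} {z} e with o Fin.≟ z
  ... | no o≢z = o≢z , e

  any-clear : ∀ os {z} → any (λ o → closedNbhd o z) os ≡ false → Clear os z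
  any-clear []       _ = []
  any-clear (o ∷ os) {z} e with ∨-false (closedNbhd o z) e
  ... | e₁ , e₂ = closedNbhd-apart e₁ ∷ any-clear os e₂

module Light (G : Graph) (p7free : P7Free G) (ν : Fin (n G) → ℚ) (ν-nonneg : ∀ u → 0ℚ ≤ℚ ν u)
             (ν-total : sumFin ν ≡ 1ℚ) where
  open Bridges G
  open Measure ν ν-nonneg ν-total

  module _ (light : ∀ o → mass (closedNbhd o) ≤ℚ β + β) where

    closedNbhds-mass : ∀ k os → length os ≤ k →
                       mass (λ z → any (λ o → closedNbhd o z) os) ≤ℚ times k (β + β)
    closedNbhds-mass k [] _ = ℚ.≤-trans (ℚ.≤-reflexive (mass-∅ {λ _ → false} λ _ → refl)) (times-nonneg k)
      where
      times-nonneg : ∀ k → 0ℚ ≤ℚ times k (β + β)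
      times-nonneg zero    = ℚ.≤-refl
      times-nonneg (suc k) = ℚ.+-mono-≤ 0≤2β (times-nonneg k)
    closedNbhds-mass (suc k) (o ∷ os) (s≤s len) = ℚ.≤-trans
      (mass-∪ {λ z → any (λ o → closedNbhd o z) (o ∷ os)} {closedNbhd o}
              {λ z → any (λ o → closedNbhd o z) os} (λ z → ∨-true (closedNbhd o z)))
      (ℚ.+-mono-≤ (light o) (closedNbhds-mass k os len))

    -- Let `R x z` mean that `z` equals or sees a vertex of the support of `x`. Supports have at
    -- most 11 vertices with light closed neighbourhoods, so out-masses are at most `ε`, and an
    -- independent triple has mutually clear supports, as `two-bridges` requires.
    no-anchored-set : ∀ {D E : Fin (n G) → Set} {c w} → D c → E w →
      (∀ {d e} → D d → E e → Apart d e) → ∀ {X} → ½γ ≤ℚ mass X →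
      (∀ x → X x ≡ true → Anchored D E c w x) → ⊥
    no-anchored-set {D} {E} {c} {w} Dc Ew anti {X} X-large anchored =
      let x , y , z , x∈X , y∈X , z∈X , (xy , yx) , (xz , zx) , (yz , zy) =
            independent-triple {R} out {X} X-large
          X , X≡ = representative x∈X
          Y , Y≡ = representative y∈X
          Z , Z≡ = representative z∈X
      in two-bridges p7free Dc Ew anti X Y Z
           (clear X≡ xy) (clear Y≡ yx) (clear X≡ xz) (clear Z≡ zx) (clear Y≡ yz) (clear Z≡ zy)
      where
      -- Paths are given only on `X`; the empty list elsewhere makes `R` total without adding
      -- conflicts.
      objects : Fin (n G) → List (Fin (n G))
      objects x with X x Bool.≟ true
      ... | yes x∈X = Anchored.support (anchored x x∈X)
      ... | no  _   = []
      objects-length : ∀ x → length (objects x) ≤ 11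
      objects-length x with X x Bool.≟ true
      ... | yes x∈X = support-length p7free (anchored x x∈X)
      ... | no  _   = z≤n
      R : Fin (n G) → VSet (n G)
      R x z = any (λ o → closedNbhd o z) (objects x)
      out : ∀ x → mass (R x) ≤ℚ ε
      out x = ℚ.≤-trans (closedNbhds-mass 11 (objects x) (objects-length x)) 11[2β]≤ε
      -- This recovers the very paths chosen by `objects`, so that clearness read off from `R`
      -- speaks about them.
      representative : ∀ {x} → X x ≡ true → Σ (Anchored D E c w x) λ a → objects x ≡ Anchored.support a
      representative {x} x∈X with X x Bool.≟ true
      ... | yes x∈X′ = anchored x x∈X′ , refl
      ... | no  x∉X  = ⊥-elim (x∉X x∈X)
      clear : ∀ {x z os} → objects x ≡ os → R x z ≡ false → Clear os z
      clear {x} refl = any-clear (objects x)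

-- Contradiction from a potential maximal clique with light neighbourhoods

¬¬-∀ : ∀ {n} {P : Fin n → Set} → (∀ i → ¬ ¬ P i) → ¬ ¬ (∀ i → P i)
¬¬-∀ {zero}  ¬¬P k = k λ ()
¬¬-∀ {suc n} ¬¬P k = ¬¬P zero λ p₀ → ¬¬-∀ (¬¬P ∘ suc) λ ps → k λ { zero → p₀ ; (suc i) → ps i }

another : ∀ {n} → 2 ≤ n → (o : Fin n) → ∃[ u ] (¬ o ≡ u)
another (s≤s (s≤s _)) zero    = suc zero , λ ()
another (s≤s (s≤s _)) (suc _) = zero , λ ()

neighbour : ∀ {G} → Connected G → 2 ≤ n G → ∀ o → ∃[ v ] (adj G v o ≡ true)
neighbour {G} connected 2≤n o with another 2≤n o
... | u , o≢u with connected o u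
...   | here           = ⊥-elim (o≢u refl)
...   | step {w = w} e _ = w , trans (symm G w o) e

does-true : ∀ {A : Set} (a? : Dec A) → does a? ≡ true → A
does-true (yes a) _ = a

not-false : ∀ {b} → ¬ b ≡ true → b ≡ false
not-false {false} _ = refl
not-false {true}  h = ⊥-elim (h refl)

module Main (G : Graph) (connected : Connected G) (p7free : P7Free G) (2≤n : 2 ≤ n G)
            (Ω : VSet (n G)) (F : BRel (n G)) (minimal : IsMinimalTriangulation G F)
            (maximal : IsMaximalClique (G +F F) Ω)
            (μ : Fin (n G) → ℚ) (prob : IsProbMeasureOn Ω μ)
            (no-heavy : ¬ (∃[ v ] (β ≤ℚ μN G Ω μ v))) where

  private
    V : Set
    V = Fin (n G)

  -- Values of `μ` outside Ω are unconstrained, so they are replaced by zero; `sumFin ν` is then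
  -- `sumOver Ω μ` by definition.
  ν : V → ℚ
  ν u = if Ω u then μ u else 0ℚ

  ν-nonneg : ∀ u → 0ℚ ≤ℚ ν u
  ν-nonneg u with Ω u | proj₁ prob u
  ... | true  | nonneg = nonneg refl
  ... | false | _      = ℚ.≤-refl

  open Measure ν ν-nonneg (proj₂ prob)
  open Bridges G

  mass-Ω : mass Ω ≡ 1ℚ
  mass-Ω = trans (sum-cong pointwise) (proj₂ prob)
    where
    pointwise : ∀ u → ν u * indicator (Ω u) ≡ ν u
    pointwise u with Ω u
    ... | true  = ℚ.*-identityʳ (μ u)
    ... | false = refl

  mass-nbhd : ∀ v → mass (adj G v) ≡ μN G Ω μ v
  mass-nbhd v = sum-cong pointwise
    where
    pointwise : ∀ u → ν u * indicator (adj G v u) ≡ (if Ω u ∧ adj G v u then μ u else 0ℚ)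
    pointwise u with Ω u | adj G v u
    ... | true  | true  = ℚ.*-identityʳ (μ u)
    ... | true  | false = ℚ.*-zeroʳ (μ u)
    ... | false | b     = ℚ.*-zeroˡ (indicator b)

  nbhd-light : ∀ v → mass (adj G v) ≤ℚ β
  nbhd-light v = ℚ.≤-trans (ℚ.≤-reflexive (mass-nbhd v)) (ℚ.<⇒≤ (ℚ.≰⇒> λ heavy → no-heavy (v , heavy)))

  -- The point `o` has at most the mass of the neighbourhood of any neighbour of `o`. Such a
  -- neighbour exists by connectedness and `2 ≤ n G`.
  light : ∀ o → mass (closedNbhd o) ≤ℚ β + β
  light o = ℚ.≤-trans
    (mass-∪ {closedNbhd o} {λ z → does (o Fin.≟ z)} {adj G o} λ z → ∨-true (does (o Fin.≟ z)))
    (ℚ.+-mono-≤ (ℚ.≤-trans (mass-mono {λ z → does (o Fin.≟ z)} {adj G v} single) (nbhd-light v))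
                (nbhd-light o))
    where
    v : V
    v = proj₁ (neighbour {G} connected 2≤n o)
    single : ∀ z → does (o Fin.≟ z) ≡ true → adj G v z ≡ true
    single z o≡z with does-true (o Fin.≟ z) o≡z
    ... | refl = proj₂ (neighbour {G} connected 2≤n o)

  module _ (conn? : ∀ u v → Dec (Conn (adj G) (λ w → Ω w ≡ false) u v)) where
    open PMC G Ω F minimal maximal conn?
    open Light G p7free ν ν-nonneg (proj₂ prob)

    N : V → VSet (n G)
    N c z = Ω z ∧ does (touch? c z)

    N⇒touch : ∀ {c z} → N c z ≡ true → Touch c z
    N⇒touch {c} {z} e = does-true (touch? c z) (Bool.∧-conicalʳ (Ω z) _ e)

    touch⇒N : ∀ {c z} → Ω z ≡ true → Touch c z → N c z ≡ true
    touch⇒N {c} {z} z∈Ω t = cong₂ _∧_ z∈Ω (dec-true (touch? c z) t)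

    component-walk : ∀ {c x y} → Ω c ≡ false → Touch c x → Touch c y → Walk (K c) y x
    component-walk c∉Ω (d , cd , dx) (e , ce , ey) =
      walk-trans (conn⇒walk (flip-edge dx) cd (conn-lift cd (conn-trans (K-sym c∉Ω cd) ce))) ce (edge ey)

    cliquish′ : ∀ {x y} → Ω x ≡ true → Ω y ≡ true → Apart x y →
                ∃[ c ] (Ω c ≡ false × Touch c x × Touch c y)
    cliquish′ x∈Ω y∈Ω (x≢y , xy) = cliquish x∈Ω y∈Ω x≢y xy

    touch-not-apart : ∀ {c d x} → K c d → ¬ Touch c x → adj G d x ≡ false
    touch-not-apart {d = d} cd untouched = not-false λ e → untouched (d , cd , e)

    large-component : ∀ {c} → Ω c ≡ false → γ ≤ℚ mass (N c) → ⊥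
    large-component {c} c∉Ω large with Fin.any? (λ w → (Ω w Bool.≟ true) ×-dec ¬? (touch? c w))
    ... | no none = not-full c∉Ω λ w w∈Ω → decidable-stable (touch? c w) λ untouched → none (w , w∈Ω , untouched)
    ... | yes (w , w∈Ω , untouched) =
      no-anchored-set light {K c} {E} nil (inj₁ refl) anti
        -- Neighbours of `w` and `w` itself are discarded so that `cliquish′` applies to each
        -- remaining `x` and `w`.
        (mass-∖ {N c} {closedNbhd w} large (light w) ½γ+2β≤γ) anchored
      where
      E : V → Set
      E e = e ≡ w ⊎ (Ω e ≡ false × ¬ K c e)
      ∉Ω : ∀ {d} → K c d → Ω d ≡ false
      ∉Ω = conn-target c∉Ω
      anti : ∀ {d e} → K c d → E e → Apart d e
      anti cd (inj₁ refl)        = (λ { refl → true≢false w∈Ω (∉Ω cd) }) , touch-not-apart cd untouched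
      anti cd (inj₂ (e∉Ω , ¬ce)) = (λ { refl → ¬ce cd }) , not-false λ de → ¬ce (conn-snoc cd de e∉Ω)
      anchored : ∀ x → N c x ∧ not (closedNbhd w x) ≡ true → Anchored (K c) E c w x
      anchored x x∈X = record { toC = proj₂ toC ; toW = proj₂ toW }
        where
        x∈Ω : Ω x ≡ true
        x∈Ω = Bool.∧-conicalˡ _ _ (Bool.∧-conicalˡ _ _ x∈X)
        cx : Touch c x
        cx = N⇒touch (Bool.∧-conicalˡ _ _ x∈X)
        xw : Apart x w
        xw = apart-sym (closedNbhd-apart (not-true⇒false (Bool.∧-conicalʳ (N c x) _ x∈X)))
        toC : ∃ (PathTo (K c) c x)
        toC = shortcut (λ { refl → true≢false x∈Ω c∉Ω })
          (conn⇒walk (flip-edge (proj₂ (proj₂ cx))) (proj₁ (proj₂ cx))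
            (conn-lift (proj₁ (proj₂ cx)) (K-sym c∉Ω (proj₁ (proj₂ cx)))))
        toW : ∃ (PathTo E w x)
        -- The component joining `x` to `w` touches `w`, so it is not the component of `c` and lies
        -- in `E`.
        toW with cliquish′ x∈Ω w∈Ω xw
        ... | c′ , c′∉Ω , c′x , c′w = shortcut (proj₁ xw)
          (walk-map (λ c′v → inj₂ (conn-target c′∉Ω c′v , λ cv →
              untouched (touch-trans (conn-trans cv (K-sym c′∉Ω c′v)) c′w)))
            (component-walk c′∉Ω c′x c′w))

    Linked : V → V → Set
    Linked x y = Ω x ≡ true × Ω y ≡ true × Apart x y

    linked? : ∀ x y → Dec (Linked x y)
    linked? x y = (Ω x Bool.≟ true) ×-dec (Ω y Bool.≟ true) ×-dec ¬? (x Fin.≟ y) ×-dec (adj G x y Bool.≟ false)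

    module SmallComponents (small : ∀ {c} → Ω c ≡ false → mass (N c) ≤ℚ γ) where

      -- Boundary of a component of G − Ω chosen to join x and y; empty unless x and y are linked.
      boundary : V → V → VSet (n G)
      boundary x y with linked? x y
      ... | yes (x∈Ω , y∈Ω , xy) = N (proj₁ (cliquish′ x∈Ω y∈Ω xy))
      ... | no  _                = λ _ → false

      boundary-mass : ∀ x y → mass (boundary x y) ≤ℚ γ
      boundary-mass x y with linked? x y
      ... | yes (x∈Ω , y∈Ω , xy) = small (proj₁ (proj₂ (cliquish′ x∈Ω y∈Ω xy)))
      ... | no  _                = ℚ.≤-trans (ℚ.≤-reflexive (mass-∅ {λ _ → false} λ _ → refl)) 0≤γ

      boundary-joins : ∀ {x y} → Linked x y →
        ∃[ c ] (Ω c ≡ false × Touch c x × Touch c y × (∀ {z} → Ω z ≡ true → boundary x y z ≡ false → ¬ Touch c z))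
      boundary-joins {x} {y} linked with linked? x y
      ... | no ¬linked = ⊥-elim (¬linked linked)
      ... | yes (x∈Ω , y∈Ω , xy) with cliquish′ x∈Ω y∈Ω xy
      ...   | c , c∉Ω , cx , cy = c , c∉Ω , cx , cy , λ z∈Ω z∉N cz → true≢false (touch⇒N z∈Ω cz) z∉N

      -- `Side r w` and `Side w r` serve as the sets `D` and `E` of an anchored set: each consists
      -- of one root and the components touching that root but not the other.
      Side : V → V → V → Set
      Side r w v = v ≡ r ⊎ (Ω v ≡ false × Touch v r × ¬ Touch v w)

      module _ {r w : V} (r∈Ω : Ω r ≡ true) (w∈Ω : Ω w ≡ true) (rw : Apart r w) where

        -- An edge between two non-root vertices would put them in one component, which would then
        -- touch both roots; an edge at a root would make a component touch the root it must miss.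
        sides-apart : ∀ {d e} → Side r w d → Side w r e → Apart d e
        sides-apart (inj₁ refl) (inj₁ refl) = rw
        sides-apart (inj₁ refl) (inj₂ (e∉Ω , _ , ¬er)) =
          (λ { refl → true≢false r∈Ω e∉Ω }) , not-false λ re → ¬er (_ , nil , flip-edge re)
        sides-apart (inj₂ (d∉Ω , _ , ¬dw)) (inj₁ refl) =
          (λ { refl → true≢false w∈Ω d∉Ω }) , not-false λ dw → ¬dw (_ , nil , dw)
        sides-apart (inj₂ (d∉Ω , dr , ¬dw)) (inj₂ (e∉Ω , ew , ¬er)) =
          (λ { refl → ¬er dr }) , not-false λ de → ¬dw (touch-trans (cons de e∉Ω nil) ew)

      -- The component chosen to join `x` and `r` misses `w` by assumption, so all its vertices lie
      -- in `Side r w`.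
      to-root : ∀ {x r w} → Linked x r → Ω w ≡ true → boundary x r w ≡ false → ∃ (PathTo (Side r w) r x)
      to-root linked@(_ , _ , xr) w∈Ω avoids with boundary-joins linked
      ... | c , c∉Ω , cx , cr , untouched = shortcut (proj₁ xr)
        (walk-map (λ cv → inj₂ (conn-target c∉Ω cv , touch-trans (K-sym c∉Ω cv) cr ,
                                λ vw → untouched w∈Ω avoids (touch-trans cv vw)))
          (component-walk c∉Ω cx cr))

      -- This measures the `x` whose chosen component towards `r` also touches `w`, where `to-root`
      -- fails.
      spoiled : V → V → ℚ
      spoiled w r = mass (λ x → boundary x r w)

      -- Integrate over `w` first: for fixed `r` and `x` the result is the mass of one boundary, at
      -- most `γ`. So the average over `w` is at most `γ`, and Markov on Ω costs a factor of two.
      first-root : ∃[ w ] (Ω w ≡ true × ∫ (λ r → spoiled w r) ≤ℚ γ + γ)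
      first-root = markov {g = λ w → ∫ (spoiled w)} {S = Ω} (λ w → ∫-nonneg λ r → mass-nonneg _)
        (ℚ.≤-trans (ℚ.≤-reflexive total) (∫-≤ λ r → ∫-≤ λ x → boundary-mass x r))
        (ℚ.≤-reflexive (sym mass-Ω)) 0≤2γ γ<2γ
        where
        total : ∫ (λ w → ∫ (λ r → spoiled w r)) ≡ ∫ (λ r → ∫ (λ x → mass (boundary x r)))
        total = trans (∫-swap spoiled)
          (∫-cong λ r → ∫-swap λ w x → indicator (boundary x r w))

      roots : ∃[ w ] ∃[ r ] (Ω w ≡ true × Ω r ≡ true × Apart w r ×
                             spoiled w r + mass (λ x → boundary x w r) ≤ℚ η)
      roots = w , r , w∈Ω , Bool.∧-conicalˡ _ _ r∈S ,
        closedNbhd-apart (not-true⇒false (Bool.∧-conicalʳ (Ω r) _ r∈S)) , r-good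
        where
        w : V
        w = proj₁ first-root
        w∈Ω : Ω w ≡ true
        w∈Ω = proj₁ (proj₂ first-root)
        g : V → ℚ
        g r = spoiled w r + mass (λ x → boundary x w r)
        total : ∫ g ≤ℚ (γ + γ) + γ
        total = ℚ.≤-trans (ℚ.≤-reflexive (∫-+ (spoiled w) (λ r → mass (λ x → boundary x w r))))
          (ℚ.+-mono-≤ (proj₂ (proj₂ first-root))
            (ℚ.≤-trans (ℚ.≤-reflexive (∫-swap λ r x → indicator (boundary x w r)))
                       (∫-≤ λ x → boundary-mass x w)))
        -- The average of `g` is at most `2γ` by the choice of `w`, plus `γ` by exchanging
        -- integrals. The admissible `r`, those in Ω apart from `w`, have mass at least `½`, so
        -- Markov needs `η` above `6γ`.
        choice : ∃[ r ] (Ω r ∧ not (closedNbhd w r) ≡ true × g r ≤ℚ η)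
        choice = markov {g = g} {S = λ r → Ω r ∧ not (closedNbhd w r)}
          (λ r → ℚ.+-mono-≤ (mass-nonneg (λ x → boundary x r w)) (mass-nonneg (λ x → boundary x w r)))
          total (mass-∖ {Ω} {closedNbhd w} (ℚ.≤-reflexive (sym mass-Ω)) (light w) ½+2β≤1) 0≤η 3γ<η½
        r : V
        r = proj₁ choice
        r∈S : Ω r ∧ not (closedNbhd w r) ≡ true
        r∈S = proj₁ (proj₂ choice)
        r-good : g r ≤ℚ η
        r-good = proj₂ (proj₂ choice)

      module _ {w r : V} (w∈Ω : Ω w ≡ true) (r∈Ω : Ω r ≡ true) (wr : Apart w r)
               (good : spoiled w r + mass (λ x → boundary x w r) ≤ℚ η) where

        private
          Spoiled NearRoots : VSet (n G)
          Spoiled x = boundary x r w ∨ boundary x w r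
          NearRoots x = closedNbhd w x ∨ (closedNbhd r x ∨ Spoiled x)

          spoiled-mass : mass Spoiled ≤ℚ η
          spoiled-mass = ℚ.≤-trans (mass-∪ {Spoiled} {λ x → boundary x r w} {λ x → boundary x w r}
                                      λ x → ∨-true (boundary x r w)) good

          nearRoots-mass : mass NearRoots ≤ℚ (β + β) + ((β + β) + η)
          nearRoots-mass = ℚ.≤-trans
            (mass-∪ {NearRoots} {closedNbhd w} {λ x → closedNbhd r x ∨ Spoiled x} λ x → ∨-true (closedNbhd w x))
            (ℚ.+-mono-≤ (light w) (ℚ.≤-trans
              (mass-∪ {λ x → closedNbhd r x ∨ Spoiled x} {closedNbhd r} {Spoiled} λ x → ∨-true (closedNbhd r x))
              (ℚ.+-mono-≤ (light r) spoiled-mass)))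

          anchored : ∀ x → Ω x ∧ not (NearRoots x) ≡ true → Anchored (Side r w) (Side w r) r w x
          anchored x x∈X =
            let x∈Ω = Bool.∧-conicalˡ (Ω x) _ x∈X
                xw , rest = ∨-false (closedNbhd w x) (not-true⇒false (Bool.∧-conicalʳ (Ω x) _ x∈X))
                xr , rest′ = ∨-false (closedNbhd r x) rest
                avoids-w , avoids-r = ∨-false (boundary x r w) rest′
            in record
              { toC = proj₂ (to-root (x∈Ω , r∈Ω , apart-sym (closedNbhd-apart xr)) w∈Ω avoids-w)
              ; toW = proj₂ (to-root (x∈Ω , w∈Ω , apart-sym (closedNbhd-apart xw)) r∈Ω avoids-r) }

        rooted-impossible : ⊥
        rooted-impossible = no-anchored-set light {Side r w} {Side w r} {r} {w} (inj₁ refl) (inj₁ refl)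
          (sides-apart r∈Ω w∈Ω (apart-sym wr))
          {λ x → Ω x ∧ not (NearRoots x)}
          -- Deleting both closed neighbourhoods and the spoiled vertices costs at most `4β + η`,
          -- which leaves mass at least `½γ`.
          (mass-∖ {Ω} {NearRoots} (ℚ.≤-reflexive (sym mass-Ω)) nearRoots-mass ½γ+4β+η≤1) anchored

      impossible : ⊥
      impossible = let _ , _ , w∈Ω , r∈Ω , wr , good = roots in rooted-impossible w∈Ω r∈Ω wr good

    no-light-pmc : ⊥
    no-light-pmc with Fin.any? (λ c → (Ω c Bool.≟ false) ×-dec (γ ≤ℚ? mass (N c)))
    ... | yes (c , c∉Ω , large) = large-component c∉Ω large
    ... | no none = SmallComponents.impossible λ c∉Ω → ℚ.<⇒≤ (ℚ.≰⇒> λ large → none (_ , c∉Ω , large))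

  absurd : ⊥
  -- As the goal is `⊥`, excluded middle may be used for every pair of vertices at once; finiteness
  -- moves the double negation outside the quantifiers.
  absurd = ¬¬-∀ (λ u → ¬¬-∀ λ v → ¬¬-excluded-middle) no-light-pmc


theorem4 : Σ ℚ λ β → 0ℚ < β ×
    ((G : Graph) → Connected G → P7Free G → 2 ≤ n G →
    (Ω : VSet (n G)) → IsPMC G Ω →
    (μ : Fin (n G) → ℚ) → IsProbMeasureOn Ω μ →
    ∃[ v ] (β Data.Rational.≤ μN G Ω μ v))
theorem4 = β , 0<β , λ G connected p7free 2≤n Ω (F , minimal , maximal) μ prob →
  -- The search over `v` is finite and the comparison decidable, so refuting the absence of a heavy
  -- vertex produces one.
  decidable-stable (Fin.any? λ v → β ≤ℚ? μN G Ω μ v)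
    (Main.absurd G connected p7free 2≤n Ω F minimal maximal μ prob)
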